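{- Let $X$ be a strongly connected finite digraph with $\delta(X)=0$. Then there exists a nonzero integer $m(X)$ such that $$g_X^*(1)=m(X)\cdot\#\mathrm{BF}(X)_{\rm tors}.$$
   Context: A digraph $X=(V_X,E_X)$ has incidence map $e\mapsto(o(e),t(e))$; it is strongly connected if for any two distinct vertices there is a directed path from the first to the second. For finite $X$: $\mathcal{A}_X:\mathbb{Z}V_X\to\mathbb{Z}V_X$, $v\mapsto\sum_{e:o(e)=v}t(e)$; Bowen--Franks operator $\mathcal{BF}_X=\mathcal{I}-\mathcal{A}_X$; $\mathrm{BF}(X)=\mathrm{coker}(\mathcal{BF}_X)$. $g_X(u)=\det(\mathcal{I}-\mathcal{A}_Xu)\in\mathbb{Z}[u]$; $r_X=\mathrm{ord}_{u=1}g_X(u)$; $g_X^*(1)$ is the first non-vanishing coefficient of the Taylor expansion of $g_X$ at $u=1$ (i.e. the coefficient of $(u-1)^{r_X}$). $\delta(X)=r_X-\mathrm{rank}_{\mathbb{Z}}\mathrm{BF}(X)$. -}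

module Defs where

open import Level using (Level; _⊔_; 0ℓ)
open import Algebra.Bundles using (AbelianGroup; RawRing)
open import Algebra.Morphism.Structures using (IsGroupHomomorphism)
open import Data.Bool.Base using (if_then_else_)
open import Data.Fin.Base using (Fin; zero; suc; toℕ; punchIn)
open import Data.Fin.Properties using (_≟_)
open import Data.Integer.Base as ℤ using (ℤ; +_; -[1+_]; 0ℤ; 1ℤ)
import Data.Integer.Properties as ℤₚ
open import Data.List.Base as List using (List; []; _∷_)
open import Data.Nat.Base as ℕ using (ℕ; zero; suc)
open import Data.Product.Base using (Σ; ∃; _×_; _,_; proj₁)
open import Data.Vec.Functional using (Vector)
open import Function.Base using (id)
open import Function.Bundles using (Inverse)
open import Relation.Binary.Bundles using (Setoid)
open import Relation.Binary.Construct.Closure.ReflexiveTransitive using (Star)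
import Relation.Binary.Construct.On as On
open import Relation.Binary.PropositionalEquality as ≡ using (_≡_; _≢_)
open import Relation.Nullary.Decidable.Core using (does)
import Algebra.Construct.Pointwise as Pointwise
import Algebra.Definitions.RawSemiring
import Algebra.Properties.AbelianGroup
import Algebra.Properties.CommutativeSemigroup
import Relation.Binary.Reasoning.Setoid
open import Algebra.Definitions.RawMonoid using () renaming (_×_ to multiple; sum to sumOf)
open import Algebra.Properties.CommutativeMonoid.Sum ℤₚ.+-0-commutativeMonoid
  using (sum-syntax; sum-cong-≗; ∑-distrib-+)

private
  variable
    c ℓ c′ ℓ′ : Level

------------------------------------------------------------------------
-- Abelian groups: cokernel, rank, torsion

-- The cokernel of φ : A → B is the carrier of B with x and y identified
-- when x - y lies in the image of φ.

module _ (A : AbelianGroup c ℓ) (B : AbelianGroup c′ ℓ′) where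

  private
    module A = AbelianGroup A
    module B = AbelianGroup B

  coker : (φ : A.Carrier → B.Carrier) →
          IsGroupHomomorphism A.rawGroup B.rawGroup φ →
          AbelianGroup c′ (c ⊔ ℓ′)
  coker φ φ-hom = record
    { Carrier = B.Carrier
    ; _≈_     = λ x y → ∃ λ z → x B.- y B.≈ φ z
    ; _∙_     = B._∙_
    ; ε       = B.ε
    ; _⁻¹     = B._⁻¹
    ; isAbelianGroup = record
      { isGroup = record
        { isMonoid = record
          { isSemigroup = record
            { isMagma = record
              { isEquivalence = record
                { refl  = lift B.refl
                ; sym   = λ {x} {y} (z , p) → z A.⁻¹ , (begin
                    y B.- x          ≈⟨ ⁻¹-anti-homo-// x y ⟨
                    (x B.- y) B.⁻¹   ≈⟨ B.⁻¹-cong p ⟩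
                    φ z B.⁻¹         ≈⟨ ⁻¹-homo z ⟨
                    φ (z A.⁻¹)       ∎)
                ; trans = λ {x} {y} {w} (z , p) (z′ , q) → z A.∙ z′ , (begin
                    x B.- w                        ≈⟨ B.∙-congʳ (B.identityʳ x) ⟨
                    (x B.∙ B.ε) B.- w              ≈⟨ B.∙-congʳ (B.∙-congˡ (B.inverseˡ y)) ⟨
                    (x B.∙ (y B.⁻¹ B.∙ y)) B.- w   ≈⟨ B.∙-congʳ (B.assoc x _ y) ⟨
                    ((x B.- y) B.∙ y) B.- w        ≈⟨ B.assoc _ y _ ⟩
                    (x B.- y) B.∙ (y B.- w)        ≈⟨ B.∙-cong p q ⟩
                    φ z B.∙ φ z′                   ≈⟨ homo z z′ ⟨
                    φ (z A.∙ z′)                   ∎)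
                }
              ; ∙-cong = λ {x} {y} {u} {v} (z , p) (z′ , q) → z A.∙ z′ , (begin
                  (x B.∙ u) B.- (y B.∙ v)             ≈⟨ B.∙-congˡ (⁻¹-∙-comm y v) ⟨
                  (x B.∙ u) B.∙ (y B.⁻¹ B.∙ v B.⁻¹)   ≈⟨ interchange x u _ _ ⟩
                  (x B.- y) B.∙ (u B.- v)             ≈⟨ B.∙-cong p q ⟩
                  φ z B.∙ φ z′                        ≈⟨ homo z z′ ⟨
                  φ (z A.∙ z′)                        ∎)
              }
            ; assoc = λ x y z → lift (B.assoc x y z)
            }
          ; identity = (λ x → lift (B.identityˡ x)) , (λ x → lift (B.identityʳ x))
          }
        ; inverse = (λ x → lift (B.inverseˡ x)) , (λ x → lift (B.inverseʳ x))
        ; ⁻¹-cong = λ {x} {y} (z , p) → z A.⁻¹ , (begin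
            x B.⁻¹ B.- y B.⁻¹   ≈⟨ ⁻¹-∙-comm x (y B.⁻¹) ⟩
            (x B.- y) B.⁻¹      ≈⟨ B.⁻¹-cong p ⟩
            φ z B.⁻¹            ≈⟨ ⁻¹-homo z ⟨
            φ (z A.⁻¹)          ∎)
        }
      ; comm = λ x y → lift (B.comm x y)
      }
    }
    where
    open IsGroupHomomorphism φ-hom using (homo; ε-homo; ⁻¹-homo)
    open Algebra.Properties.AbelianGroup B
      using (x≈y⇒x∙y⁻¹≈ε; ⁻¹-∙-comm; ⁻¹-anti-homo-//)
    open Algebra.Properties.CommutativeSemigroup B.commutativeSemigroup
      using (interchange)
    open Relation.Binary.Reasoning.Setoid B.setoid

    lift : ∀ {x y} → x B.≈ y → ∃ λ z → x B.- y B.≈ φ z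
    lift x≈y = A.ε , B.trans (x≈y⇒x∙y⁻¹≈ε x≈y) (B.sym ε-homo)

module _ (G : AbelianGroup c ℓ) where

  open AbelianGroup G

  infixr 8 _·_

  _·_ : ℤ → Carrier → Carrier
  (+ n)    · x = multiple rawMonoid n x
  -[1+ n ] · x = (multiple rawMonoid (suc n) x) ⁻¹

  LinearlyIndependent : ∀ {k} → Vector Carrier k → Set ℓ
  LinearlyIndependent {k} x =
    (a : Vector ℤ k) → sumOf rawMonoid (λ i → a i · x i) ≈ ε → ∀ i → a i ≡ 0ℤ

  -- The ℤ-rank is the maximal size of a ℤ-linearly independent family.
  HasRank : ℕ → Set (c ⊔ ℓ)
  HasRank ρ =
    (Σ (Vector Carrier ρ) LinearlyIndependent) ×
    (∀ k → (x : Vector Carrier k) → LinearlyIndependent x → k ℕ.≤ ρ)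

  IsTorsion : Carrier → Set ℓ
  IsTorsion x = ∃ λ n → n ≢ 0 × multiple rawMonoid n x ≈ ε

  torsion : Setoid (c ⊔ ℓ) ℓ
  torsion = On.setoid {B = Σ Carrier IsTorsion} setoid proj₁

HasCardinality : Setoid c ℓ → ℕ → Set (c ⊔ ℓ)
HasCardinality S N = Inverse S (≡.setoid (Fin N))

------------------------------------------------------------------------
-- Determinants over a ring, by expansion along the first row

module _ (R : RawRing c ℓ) where

  open RawRing R
  open Algebra.Definitions.RawSemiring rawSemiring using (sum; _^_)

  det : ∀ {n} → (Fin n → Fin n → Carrier) → Carrier
  det {zero}  M = 1#
  det {suc n} M = sum λ j →
    (- 1#) ^ toℕ j * (M zero j * det λ i k → M (suc i) (punchIn j k))

------------------------------------------------------------------------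
-- Integer polynomials

-- Coefficient lists, constant term first; trailing zeros are permitted,
-- so equality is equality of all coefficients.

ℤ[u] : Set
ℤ[u] = List ℤ

coeff : ℤ[u] → ℕ → ℤ
coeff []      _       = 0ℤ
coeff (a ∷ p) zero    = a
coeff (a ∷ p) (suc k) = coeff p k

infixl 6 _+ₚ_
infixl 7 _*ₚ_

_+ₚ_ : ℤ[u] → ℤ[u] → ℤ[u]
[]      +ₚ q       = q
(a ∷ p) +ₚ []      = a ∷ p
(a ∷ p) +ₚ (b ∷ q) = a ℤ.+ b ∷ p +ₚ q

_*ₚ_ : ℤ[u] → ℤ[u] → ℤ[u]
[]      *ₚ q = []
(a ∷ p) *ₚ q = List.map (a ℤ.*_) q +ₚ (0ℤ ∷ p *ₚ q)

-ₚ_ : ℤ[u] → ℤ[u]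
-ₚ_ = List.map (λ a → ℤ.- a)

constant : ℤ → ℤ[u]
constant a = a ∷ []

u : ℤ[u]
u = 0ℤ ∷ 1ℤ ∷ []

ℤ[u]-rawRing : RawRing 0ℓ 0ℓ
ℤ[u]-rawRing = record
  { Carrier = ℤ[u]
  ; _≈_     = λ p q → ∀ k → coeff p k ≡ coeff q k
  ; _+_     = _+ₚ_
  ; _*_     = _*ₚ_
  ; -_      = -ₚ_
  ; 0#      = []
  ; 1#      = constant 1ℤ
  }

-- The coefficients b₀, b₁, … with p(u) = Σₖ bₖ (u - a)ᵏ, computed by
-- Horner's rule as the coefficients of p(a + s) in s.

taylor : ℤ → ℤ[u] → ℤ[u]
taylor a []      = []
taylor a (b ∷ p) = constant b +ₚ (a ∷ 1ℤ ∷ []) *ₚ taylor a p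

leadingZeros : List ℤ → ℕ
leadingZeros []      = 0
leadingZeros (b ∷ p) = if does (b ℤₚ.≟ 0ℤ) then suc (leadingZeros p) else 0

-- Meaningful only for p ≠ 0; for p = 0 the value is junk.
ord : ℤ → ℤ[u] → ℕ
ord a p = leadingZeros (taylor a p)

------------------------------------------------------------------------
-- Digraphs

record FiniteDigraph : Set where
  field
    ∣V∣ ∣E∣ : ℕ
    o t     : Fin ∣E∣ → Fin ∣V∣

module _ (X : FiniteDigraph) where

  open FiniteDigraph X

  Adjacent : Fin ∣V∣ → Fin ∣V∣ → Set
  Adjacent v w = ∃ λ e → o e ≡ v × t e ≡ w

  StronglyConnected : Set
  StronglyConnected = ∀ v w → v ≢ w → Star Adjacent v w

  ℤV : AbelianGroup 0ℓ 0ℓ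
  ℤV = Pointwise.abelianGroup (Fin ∣V∣) ℤₚ.+-0-abelianGroup

  open AbelianGroup ℤV using (Carrier; rawGroup)

  basis : Fin ∣V∣ → Carrier
  basis v w = if does (v ≟ w) then 1ℤ else 0ℤ

  -- The value Σ_{e : o(e) = v} t(e) of 𝒜 at the vertex v.
  targets : Fin ∣V∣ → Carrier
  targets v w = ∑[ e < ∣E∣ ] (if does (o e ≟ v) then basis (t e) w else 0ℤ)

  𝒜 : Carrier → Carrier
  𝒜 x w = ∑[ v < ∣V∣ ] (x v ℤ.* targets v w)

  ℬℱ : Carrier → Carrier
  ℬℱ x w = x w ℤ.- 𝒜 x w

  matrix : (Carrier → Carrier) → Fin ∣V∣ → Fin ∣V∣ → ℤ
  matrix f i j = f (basis j) i

  private
    𝒜-cong : ∀ {x y : Carrier} → (∀ v → x v ≡ y v) → ∀ w → 𝒜 x w ≡ 𝒜 y w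
    𝒜-cong x≗y w = sum-cong-≗ λ v → ≡.cong (ℤ._* targets v w) (x≗y v)

    𝒜-homo : ∀ (x y : Carrier) w → 𝒜 (λ v → x v ℤ.+ y v) w ≡ 𝒜 x w ℤ.+ 𝒜 y w
    𝒜-homo x y w = ≡.trans
      (sum-cong-≗ λ v → ℤₚ.*-distribʳ-+ (targets v w) (x v) (y v))
      (∑-distrib-+ (λ v → x v ℤ.* targets v w) (λ v → y v ℤ.* targets v w))

    ℬℱ-cong : ∀ {x y : Carrier} → (∀ v → x v ≡ y v) → ∀ w → ℬℱ x w ≡ ℬℱ y w
    ℬℱ-cong x≗y w = ≡.cong₂ ℤ._-_ (x≗y w) (𝒜-cong x≗y w)

    ℬℱ-homo : ∀ (x y : Carrier) w →
              ℬℱ (λ v → x v ℤ.+ y v) w ≡ ℬℱ x w ℤ.+ ℬℱ y w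
    ℬℱ-homo x y w = begin
      (x w ℤ.+ y w) ℤ.- 𝒜 (λ v → x v ℤ.+ y v) w
        ≡⟨ ≡.cong (ℤ._-_ (x w ℤ.+ y w)) (𝒜-homo x y w) ⟩
      (x w ℤ.+ y w) ℤ.- (𝒜 x w ℤ.+ 𝒜 y w)
        ≡⟨ ≡.cong (ℤ._+_ (x w ℤ.+ y w)) (ℤₚ.neg-distrib-+ (𝒜 x w) (𝒜 y w)) ⟩
      (x w ℤ.+ y w) ℤ.+ (ℤ.- 𝒜 x w ℤ.+ ℤ.- 𝒜 y w)
        ≡⟨ interchange (x w) (y w) _ _ ⟩
      ℬℱ x w ℤ.+ ℬℱ y w ∎
      where
      open ≡.≡-Reasoning
      open Algebra.Properties.CommutativeSemigroup ℤₚ.+-commutativeSemigroup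
        using (interchange)

    module G = Algebra.Properties.AbelianGroup ℤₚ.+-0-abelianGroup

    ℬℱ-ε : ∀ w → ℬℱ (λ _ → 0ℤ) w ≡ 0ℤ
    ℬℱ-ε w = G.identityˡ-unique _ _ (≡.sym (ℬℱ-homo (λ _ → 0ℤ) (λ _ → 0ℤ) w))

  ℬℱ-isGroupHomomorphism : IsGroupHomomorphism rawGroup rawGroup ℬℱ
  ℬℱ-isGroupHomomorphism = record
    { isMonoidHomomorphism = record
      { isMagmaHomomorphism = record
        { isRelHomomorphism = record { cong = ℬℱ-cong }
        ; homo              = ℬℱ-homo
        }
      ; ε-homo = ℬℱ-ε
      }
    ; ⁻¹-homo = λ x w → G.inverseˡ-unique _ _ (≡.trans
        (≡.sym (ℬℱ-homo (λ v → ℤ.- x v) x w))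
        (≡.trans (ℬℱ-cong (λ v → ℤₚ.+-inverseˡ (x v)) w) (ℬℱ-ε w)))
    }

  BF : AbelianGroup 0ℓ 0ℓ
  BF = coker ℤV ℤV ℬℱ ℬℱ-isGroupHomomorphism

  g : ℤ[u]
  g = det ℤ[u]-rawRing λ i j →
    constant (matrix id i j) +ₚ (-ₚ (constant (matrix 𝒜 i j) *ₚ u))

  -- g(0) = 1, so g ≠ 0 and its order at u = 1 is meaningful.
  r : ℕ
  r = ord 1ℤ g

  g*⟨1⟩ : ℤ
  g*⟨1⟩ = coeff (taylor 1ℤ g) r

  -- δ(X), as a function of the ℤ-rank ρ of BF(X).
  δ : ℕ → ℤ
  δ ρ = + r ℤ.- + ρ

{-# OPTIONS --safe #-}

-- Let B = I − A and let L = B ℤⁿ. Choose a basis of ℤⁿ in which L consists of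
-- the vectors whose i-th coordinate is divisible by dᵢ. Then #BF(X)_tors is the
-- product N of the nonzero dᵢ, and the rank of BF(X) is the number z of zeros
-- among the dᵢ. Instead of comparing Taylor coefficients, evaluate g at 1 + N:
-- the matrix I − (1 + N) A = (1 + N) B − N I has its i-th row, in the adapted
-- basis, divisible by dᵢ if dᵢ ≠ 0 and by N if dᵢ = 0, so N^z · N divides its
-- determinant g(1 + N). On the other hand g(1 + N) = N^r (g*(1) + N t) for some
-- integer t, where r = z because δ(X) = 0; hence N divides g*(1).

module Submission where

open import Defs
open import Data.Integer using (ℤ; +_; 0ℤ; _*_)
open import Data.Nat using (ℕ)
open import Data.Product using (∃; ∃-syntax; _×_)
open import Relation.Binary.PropositionalEquality using (_≡_; _≢_)

open import Algebra.Bundles using (AbelianGroup; CommutativeRing; RawRing; Semiring)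
import Algebra.Definitions.RawSemiring
open import Algebra.Definitions.RawMonoid using () renaming (_×_ to multiple; sum to sumOf)
open import Data.Bool.Base using (if_then_else_)
open import Data.Fin.Base using (Fin; zero; suc; toℕ; fromℕ<; inject₁; punchIn; punchOut; remQuot) renaming (combine to pair)
open import Data.Fin.Permutation using (Permutation; permutation; _⟨$⟩ʳ_; _⟨$⟩ˡ_; transpose; inverseʳ; inverseˡ)
open import Data.Fin.Properties
  using (_≟_; any?; suc-injective; toℕ-injective; toℕ-inject₁; toℕ-fromℕ<; toℕ<n; punchInᵢ≢i;
         punchIn-punchOut; punchOut-punchIn; punchOut-cong; punchOut-injective; injective⇒≤;
         remQuot-combine; combine-remQuot)
open import Data.Integer.Base
  using (1ℤ; -[1+_]; ∣_∣; NonZero; ≢-nonZero; _+_; _-_; -_; _^_; _⊖_; _%_; _/_; _%ℕ_; _/ℕ_)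
open import Data.Integer.DivMod using (a≡a%n+[a/n]*n; n%d<d; n%ℕd<d; a≡a%ℕn+[a/ℕn]*n)
open import Data.Integer.Divisibility.Signed
open import Data.Integer.Properties as ℤₚ
  using (+-identityˡ; +-identityʳ; +-inverseʳ; +-assoc; *-identityˡ; *-identityʳ; *-zeroʳ; *-assoc; *-comm;
         +-*-commutativeRing; *-1-commutativeMonoid; +-injective; *-cancelˡ-≡; i-j≡0⇒i≡j; i*j≡0⇒i≡0∨j≡0;
         i^n≡0⇒i≡0; m-n≡m⊖n; ∣m⊝n∣≤m⊔n; pos-*; neg-distribˡ-*)
open import Data.Integer.Tactic.RingSolver using (solve-∀)
open import Data.List.Base as List using ([]; _∷_)
open import Data.Nat.Base as ℕ using (zero; suc)
open import Data.Nat.DivMod using (m<n⇒m%n≡m)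
import Data.Nat.Divisibility as ℕ∣
open import Data.Nat.Induction using (<-wellFounded)
import Data.Nat.Properties as ℕₚ
open import Data.Product.Base using (Σ; _,_; proj₁; proj₂)
open import Data.Sum.Base using (_⊎_; inj₁; inj₂)
open import Data.Vec.Functional using (Vector; head; tail; foldr; insertAt; updateAt) renaming (_∷_ to infixr 5 _∷ᵛ_)
open import Data.Vec.Functional.Properties using (insertAt-lookup; insertAt-punchIn; updateAt-updates; updateAt-minimal)
open import Function.Base using (_∘_; id; const)
open import Function.Definitions using (Injective)
open import Induction.WellFounded using (Acc; acc)
open import Relation.Binary.Definitions using (tri<; tri≈; tri>)
open import Relation.Binary.PropositionalEquality
  using (refl; sym; trans; cong; cong₂; subst; subst₂; _≗_; module ≡-Reasoning)
open import Relation.Nullary using (yes; no; does; contradiction)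
open import Relation.Nullary.Decidable using (¬?; decidable-stable; _×-dec_)
open import Algebra.Properties.CommutativeMonoid.Sum *-1-commutativeMonoid
  using () renaming (sum to product; sum-permute to product-permute)
open import Algebra.Properties.Semiring.Sum (CommutativeRing.semiring +-*-commutativeRing)
  using (sum; sum-remove; sum-cong-≗; ∑-distrib-+; *-distribˡ-sum)

-- The point 1 + N is chosen because N is a multiple of every nonzero dᵢ: the term -N I then spoils
-- no divisibility at a coordinate with dᵢ nonzero, and it supplies a factor N at each coordinate
-- with dᵢ = 0. Evaluating at an integer also keeps the determinant argument inside ℤ. The
-- divisibility of the determinant comes from expanding its columns in the adapted basis, with basis
-- vector i scaled by the divisor of coordinate i. A choice of basis vectors with a repetition
-- contributes 0; any other choice uses each basis vector once and contributes a multiple of the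
-- product of the divisors. The determinant thus enters as an alternating multilinear function of
-- its columns. The adapted basis comes from Euclidean row and column reduction of a generating
-- matrix of L. The quotient m is nonzero because g(0) = 1 keeps the leading Taylor coefficient from
-- vanishing.

private
  module ℤʳ = Algebra.Definitions.RawSemiring (Semiring.rawSemiring (CommutativeRing.semiring +-*-commutativeRing))
  module ℤ[u]ʳ = Algebra.Definitions.RawSemiring (RawRing.rawSemiring ℤ[u]-rawRing)

  variable
    m n k : ℕ

-- Finite sums of integers

sum-zero : (t : Vector ℤ n) → (∀ i → t i ≡ 0ℤ) → sum t ≡ 0ℤ
sum-zero {zero}  t t≡0 = refl
sum-zero {suc n} t t≡0 = cong₂ _+_ (t≡0 zero) (sum-zero (tail t) (t≡0 ∘ suc))

sum-linear : ∀ a b (s t : Vector ℤ n) →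
  sum (λ i → a * s i + b * t i) ≡ a * sum s + b * sum t
sum-linear a b s t = trans (∑-distrib-+ (λ i → a * s i) (λ i → b * t i))
  (sym (cong₂ _+_ (*-distribˡ-sum a s) (*-distribˡ-sum b t)))

-- Shaped for the first-row expansion of a determinant with two equal adjacent columns: two terms
-- cancel and the remaining ones vanish.
sum-adjacent-cancel : (t : Vector ℤ (suc n)) (k : Fin n) →
  t (inject₁ k) + t (suc k) ≡ 0ℤ →
  (∀ j → j ≢ inject₁ k → j ≢ suc k → t j ≡ 0ℤ) → sum t ≡ 0ℤ
sum-adjacent-cancel {suc n} t zero cancel rest = begin
  t zero + (t (suc zero) + sum (tail (tail t))) ≡⟨ +-assoc (t zero) _ _ ⟨
  t zero + t (suc zero) + sum (tail (tail t))   ≡⟨ cong₂ _+_ cancel (sum-zero _ λ i → rest (suc (suc i)) (λ ()) (λ ())) ⟩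
  0ℤ                                            ∎
  where open ≡-Reasoning
sum-adjacent-cancel {suc n} t (suc k) cancel rest = cong₂ _+_
  (rest zero (λ ()) (λ ()))
  (sum-adjacent-cancel (tail t) k cancel λ j j≢ j≢′ → rest (suc j) (j≢ ∘ suc-injective) (j≢′ ∘ suc-injective))

sum-δ : (k : Fin n) (t : Vector ℤ n) → (∀ j → j ≢ k → t j ≡ 0ℤ) → sum t ≡ t k
sum-δ zero    t off = trans (cong (_+_ (t zero)) (sum-zero _ λ i → off (suc i) λ ())) (+-identityʳ _)
sum-δ (suc k) t off = trans (cong₂ _+_ (off zero λ ()) (sum-δ k (tail t) λ j j≢k → off (suc j) (j≢k ∘ suc-injective))) (+-identityˡ _)

-- Determinant as a function of the columns

ℤⁿ : ℕ → Set
ℤⁿ = Vector ℤ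

detℤ : (Fin n → Fin n → ℤ) → ℤ
detℤ = det (CommutativeRing.rawRing +-*-commutativeRing)

sign : Fin n → ℤ
sign j = (- 1ℤ) ℤʳ.^ toℕ j

-- Columns are the natural argument: column j of `matrix` is the image of the basis vector j, so
-- lattice membership is a statement about columns.
detᶜ : Vector (ℤⁿ n) n → ℤ
detᶜ c = detℤ λ i j → c j i

minor : Vector (ℤⁿ (suc n)) (suc n) → Fin (suc n) → Vector (ℤⁿ n) n
minor c j k i = c (punchIn j k) (suc i)

detᶜ-cong : {c c′ : Vector (ℤⁿ n) n} → (∀ j → c j ≗ c′ j) → detᶜ c ≡ detᶜ c′
detᶜ-cong {zero}  c≗c′ = refl
detᶜ-cong {suc n} {c} {c′} c≗c′ = sum-cong-≗ {suc n} λ j →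
  cong (sign j *_) (cong₂ _*_ (c≗c′ j zero) (detᶜ-cong {c = minor c j} {c′ = minor c′ j} λ k i → c≗c′ (punchIn j k) (suc i)))

-- Linearity is stated for any three families that agree away from i, so no particular way of
-- updating a column is imposed. The number k of columns is separate from n because fixing a column
-- lowers k alone.
record Multilinear {n k : ℕ} (f : Vector (ℤⁿ n) k → ℤ) : Set where
  field
    congruent : ∀ {c c′} → (∀ j → c j ≗ c′ j) → f c ≡ f c′
    linear    : ∀ i a b {c c′ c″} →
      (∀ j → j ≢ i → (c″ j ≗ c j) × (c″ j ≗ c′ j)) →
      (∀ l → c″ i l ≡ a * c i l + b * c′ i l) →
      f c″ ≡ a * f c + b * f c′

-- In the term that deletes column i, the first-row entry carries the linearity and the minor is
-- common to all three families. In every other term the entry is common and the minor is linear by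
-- induction.
detᶜ-linear : (i : Fin n) (a b : ℤ) {c c′ c″ : Vector (ℤⁿ n) n} →
  (∀ j → j ≢ i → (c″ j ≗ c j) × (c″ j ≗ c′ j)) →
  (∀ l → c″ i l ≡ a * c i l + b * c′ i l) →
  detᶜ c″ ≡ a * detᶜ c + b * detᶜ c′
detᶜ-linear {suc n} i a b {c} {c′} {c″} off at = trans (sum-cong-≗ {suc n} termwise)
  (sum-linear a b (term c) (term c′))
  where
  term : Vector (ℤⁿ (suc n)) (suc n) → Vector ℤ (suc n)
  term c j = sign j * (c j zero * detᶜ (minor c j))

  scale : ∀ s x y z a b → s * ((a * x + b * y) * z) ≡ a * (s * (x * z)) + b * (s * (y * z))
  scale = solve-∀

  scale′ : ∀ s x y z a b → s * (x * (a * y + b * z)) ≡ a * (s * (x * y)) + b * (s * (x * z))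
  scale′ = solve-∀

  termwise : ∀ j → term c″ j ≡ a * term c j + b * term c′ j
  termwise j with j ≟ i
  ... | yes refl = begin
    sign j * (c″ j zero * detᶜ (minor c″ j))
      ≡⟨ cong (λ x → sign j * (x * detᶜ (minor c″ j))) (at zero) ⟩
    sign j * ((a * c j zero + b * c′ j zero) * detᶜ (minor c″ j))
      ≡⟨ scale (sign j) (c j zero) (c′ j zero) (detᶜ (minor c″ j)) a b ⟩
    a * (sign j * (c j zero * detᶜ (minor c″ j))) + b * (sign j * (c′ j zero * detᶜ (minor c″ j)))
      ≡⟨ cong₂ (λ x y → a * (sign j * (c j zero * x)) + b * (sign j * (c′ j zero * y)))
           (detᶜ-cong {n} λ k l → proj₁ (off _ (punchInᵢ≢i j k)) (suc l))
           (detᶜ-cong {n} λ k l → proj₂ (off _ (punchInᵢ≢i j k)) (suc l)) ⟩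
    a * term c j + b * term c′ j ∎
    where open ≡-Reasoning
  ... | no j≢i = begin
    sign j * (c″ j zero * detᶜ (minor c″ j))
      ≡⟨ cong (λ x → sign j * (c″ j zero * x)) minors ⟩
    sign j * (c″ j zero * (a * detᶜ (minor c j) + b * detᶜ (minor c′ j)))
      ≡⟨ scale′ (sign j) (c″ j zero) (detᶜ (minor c j)) (detᶜ (minor c′ j)) a b ⟩
    a * (sign j * (c″ j zero * detᶜ (minor c j))) + b * (sign j * (c″ j zero * detᶜ (minor c′ j)))
      ≡⟨ cong₂ (λ x y → a * (sign j * (x * detᶜ (minor c j))) + b * (sign j * (y * detᶜ (minor c′ j))))
           (proj₁ (off j j≢i) zero) (proj₂ (off j j≢i) zero) ⟩
    a * term c j + b * term c′ j ∎
    where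
    open ≡-Reasoning
    i′ = punchOut j≢i

    away : ∀ k → k ≢ i′ → punchIn j k ≢ i
    away k k≢i′ eq = k≢i′ (trans (sym (punchOut-punchIn j)) (punchOut-cong j eq))

    minors : detᶜ (minor c″ j) ≡ a * detᶜ (minor c j) + b * detᶜ (minor c′ j)
    minors = detᶜ-linear i′ a b
      (λ k k≢i′ → (λ l → proj₁ (off _ (away k k≢i′)) (suc l)) , (λ l → proj₂ (off _ (away k k≢i′)) (suc l)))
      (λ l → subst (λ q → c″ q (suc l) ≡ a * c q (suc l) + b * c′ q (suc l)) (sym (punchIn-punchOut j≢i)) (at (suc l)))

detᶜ-multilinear : Multilinear (detᶜ {n})
detᶜ-multilinear = record { congruent = detᶜ-cong ; linear = detᶜ-linear }

-- Deleting a third column keeps two neighbours adjacent, so the minor falls under the induction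
-- hypothesis of `detᶜ-adjacent-equal`.
punchIn-adjacent : (j : Fin (suc (suc n))) (k : Fin (suc n)) → j ≢ inject₁ k → j ≢ suc k →
  ∃ λ k′ → punchIn j (inject₁ k′) ≡ inject₁ k × punchIn j (suc k′) ≡ suc k
punchIn-adjacent         zero          zero    j≢ j≢′ = contradiction refl j≢
punchIn-adjacent         zero          (suc k) j≢ j≢′ = k , refl , refl
punchIn-adjacent         (suc zero)    zero    j≢ j≢′ = contradiction refl j≢′
punchIn-adjacent {suc n} (suc (suc j)) zero    j≢ j≢′ = zero , refl , refl
punchIn-adjacent {suc n} (suc j)       (suc k) j≢ j≢′ with punchIn-adjacent j k (j≢ ∘ cong suc) (j≢′ ∘ cong suc)
... | k′ , eq , eq′ = suc k′ , cong suc eq , cong suc eq′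

-- Deleting one or the other of two neighbours leaves the same columns, except that the survivor
-- differs; when the two are equal, the minors coincide.
punchIn-inject₁-suc : (k l : Fin n) → punchIn (inject₁ k) l ≡ punchIn (suc k) l ⊎
  (punchIn (inject₁ k) l ≡ suc k × punchIn (suc k) l ≡ inject₁ k)
punchIn-inject₁-suc zero    zero    = inj₂ (refl , refl)
punchIn-inject₁-suc zero    (suc l) = inj₁ refl
punchIn-inject₁-suc (suc k) zero    = inj₁ refl
punchIn-inject₁-suc (suc k) (suc l) with punchIn-inject₁-suc k l
... | inj₁ eq         = inj₁ (cong suc eq)
... | inj₂ (eq , eq′) = inj₂ (cong suc eq , cong suc eq′)

-- The terms deleting one of the two equal columns have equal entries and minors and opposite signs;
-- every other minor still contains both columns.
detᶜ-adjacent-equal : (k : Fin n) (c : Vector (ℤⁿ (suc n)) (suc n)) → c (inject₁ k) ≗ c (suc k) → detᶜ c ≡ 0ℤ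
detᶜ-adjacent-equal {suc n} k c eq = sum-adjacent-cancel {suc n} (λ j → sign j * (c j zero * detᶜ (minor c j))) k cancel rest
  where
  minors : ∀ l → c (punchIn (inject₁ k) l) ≗ c (punchIn (suc k) l)
  minors l i with punchIn-inject₁-suc k l
  ... | inj₁ p       = cong (λ q → c q i) p
  ... | inj₂ (p , q) rewrite p | q = sym (eq i)

  opposite : ∀ s x y → s * (x * y) + (- 1ℤ * s) * (x * y) ≡ 0ℤ
  opposite = solve-∀

  cancel : sign (inject₁ k) * (c (inject₁ k) zero * detᶜ (minor c (inject₁ k)))
    + sign (suc k) * (c (suc k) zero * detᶜ (minor c (suc k))) ≡ 0ℤ
  cancel = begin
    sign (inject₁ k) * (c (inject₁ k) zero * detᶜ (minor c (inject₁ k)))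
      + sign (suc k) * (c (suc k) zero * detᶜ (minor c (suc k)))
      ≡⟨ cong (_+ (sign (suc k) * (c (suc k) zero * detᶜ (minor c (suc k)))))
           (cong₂ _*_ (cong (ℤʳ._^_ (- 1ℤ)) (toℕ-inject₁ k))
           (cong₂ _*_ (eq zero) (detᶜ-cong {suc n} λ l i → minors l (suc i)))) ⟩
    sign k * (c (suc k) zero * detᶜ (minor c (suc k))) + (- 1ℤ * sign k) * (c (suc k) zero * detᶜ (minor c (suc k)))
      ≡⟨ opposite (sign k) (c (suc k) zero) (detᶜ (minor c (suc k))) ⟩
    0ℤ ∎
    where open ≡-Reasoning

  rest : ∀ j → j ≢ inject₁ k → j ≢ suc k → sign j * (c j zero * detᶜ (minor c j)) ≡ 0ℤ
  rest j j≢ j≢′ with punchIn-adjacent j k j≢ j≢′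
  ... | k′ , p , q = begin
    sign j * (c j zero * detᶜ (minor c j))
      ≡⟨ cong (λ x → sign j * (c j zero * x)) (detᶜ-adjacent-equal k′ (minor c j) λ i →
           subst₂ (λ a b → c a (suc i) ≡ c b (suc i)) (sym p) (sym q) (eq (suc i))) ⟩
    sign j * (c j zero * 0ℤ) ≡⟨ cong (sign j *_) (*-zeroʳ (c j zero)) ⟩
    sign j * 0ℤ              ≡⟨ *-zeroʳ (sign j) ⟩
    0ℤ                       ∎
    where open ≡-Reasoning

-- Antisymmetry and equality of arbitrary columns

module _ (c : Vector (ℤⁿ n) k) {a b : Fin k} (a≢b : a ≢ b) where

  replace₂ : ℤⁿ n → ℤⁿ n → Vector (ℤⁿ n) k
  replace₂ p q = updateAt (updateAt c a (const p)) b (const q)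

  replace₂-fst : ∀ p q → replace₂ p q a ≡ p
  replace₂-fst p q = trans (updateAt-minimal a b _ a≢b) (updateAt-updates a c)

  replace₂-snd : ∀ p q → replace₂ p q b ≡ q
  replace₂-snd p q = updateAt-updates b _

  replace₂-other : ∀ p q {j} → j ≢ a → j ≢ b → replace₂ p q j ≡ c j
  replace₂-other p q j≢a j≢b = trans (updateAt-minimal _ b _ j≢b) (updateAt-minimal _ a c j≢a)

module _ {f : Vector (ℤⁿ n) k → ℤ} (f-multilinear : Multilinear f) where

  open Multilinear f-multilinear

  -- Polarisation: with p + q in both places the value is 0, and of its four terms those with p
  -- twice or q twice vanish. The sum is written 1 · p + 1 · q to fit `linear`.
  alternating⇒antisymmetric : ∀ {a b} (a≢b : a ≢ b) → (∀ c → c a ≗ c b → f c ≡ 0ℤ) →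
    ∀ c p q → f (replace₂ c a≢b p q) + f (replace₂ c a≢b q p) ≡ 0ℤ
  alternating⇒antisymmetric {a} {b} a≢b alternating c p q = begin
    f (F p q) + f (F q p)
      ≡⟨ drop-zeros (f (F p q)) (f (F q p)) ⟩
    1ℤ * (1ℤ * 0ℤ + 1ℤ * f (F p q)) + 1ℤ * (1ℤ * f (F q p) + 1ℤ * 0ℤ)
      ≡⟨ cong₂ (λ x y → 1ℤ * (1ℤ * x + 1ℤ * f (F p q)) + 1ℤ * (1ℤ * f (F q p) + 1ℤ * y)) (diagonal p) (diagonal q) ⟨
    1ℤ * (1ℤ * f (F p p) + 1ℤ * f (F p q)) + 1ℤ * (1ℤ * f (F q p) + 1ℤ * f (F q q))
      ≡⟨ cong₂ (λ x y → 1ℤ * x + 1ℤ * y) (linear₂ p) (linear₂ q) ⟨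
    1ℤ * f (F p p+q) + 1ℤ * f (F q p+q)
      ≡⟨ linear₁ p+q ⟨
    f (F p+q p+q)
      ≡⟨ diagonal p+q ⟩
    0ℤ ∎
    where
    open ≡-Reasoning
    F = replace₂ c a≢b
    p+q = λ l → 1ℤ * p l + 1ℤ * q l

    drop-zeros : ∀ x y → x + y ≡ 1ℤ * (1ℤ * 0ℤ + 1ℤ * x) + 1ℤ * (1ℤ * y + 1ℤ * 0ℤ)
    drop-zeros = solve-∀

    diagonal : ∀ r → f (F r r) ≡ 0ℤ
    diagonal r = alternating (F r r) λ l → cong (λ v → v l) (trans (replace₂-fst c a≢b r r) (sym (replace₂-snd c a≢b r r)))

    off : ∀ {r r′ s s′ j} → (j ≢ a ⊎ r ≡ r′) → (j ≢ b ⊎ s ≡ s′) → F r s j ≗ F r′ s′ j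
    off {r} {r′} {s} {s′} {j} ra sb l with j ≟ a | j ≟ b
    off {r} {r′} {s} {s′} (inj₁ j≢a) sb l | yes refl | _ = contradiction refl j≢a
    off {r} {r′} {s} {s′} (inj₂ refl) sb l | yes refl | _ =
      cong (λ v → v l) (trans (replace₂-fst c a≢b r s) (sym (replace₂-fst c a≢b r s′)))
    off {r} {r′} {s} {s′} ra (inj₁ j≢b) l | no _ | yes refl = contradiction refl j≢b
    off {r} {r′} {s} {s′} ra (inj₂ refl) l | no _ | yes refl =
      cong (λ v → v l) (trans (replace₂-snd c a≢b r s) (sym (replace₂-snd c a≢b r′ s)))
    off {r} {r′} {s} {s′} ra sb l | no j≢a | no j≢b = cong (λ v → v l)
      (trans (replace₂-other c a≢b r s j≢a j≢b) (sym (replace₂-other c a≢b r′ s′ j≢a j≢b)))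

    linear₁ : ∀ s → f (F p+q s) ≡ 1ℤ * f (F p s) + 1ℤ * f (F q s)
    linear₁ s = linear a 1ℤ 1ℤ
      (λ j j≢a → off (inj₁ j≢a) (inj₂ refl) , off (inj₁ j≢a) (inj₂ refl))
      (λ l → trans (cong (λ v → v l) (replace₂-fst c a≢b p+q s))
        (sym (cong₂ (λ v w → 1ℤ * v l + 1ℤ * w l) (replace₂-fst c a≢b p s) (replace₂-fst c a≢b q s))))

    linear₂ : ∀ r → f (F r p+q) ≡ 1ℤ * f (F r p) + 1ℤ * f (F r q)
    linear₂ r = linear b 1ℤ 1ℤ
      (λ j j≢b → off (inj₂ refl) (inj₁ j≢b) , off (inj₂ refl) (inj₁ j≢b))
      (λ l → trans (cong (λ v → v l) (replace₂-snd c a≢b r p+q))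
        (sym (cong₂ (λ v w → 1ℤ * v l + 1ℤ * w l) (replace₂-snd c a≢b r p) (replace₂-snd c a≢b r q))))

  replace₂-self : ∀ {a b} (a≢b : a ≢ b) c → f (replace₂ c a≢b (c a) (c b)) ≡ f c
  replace₂-self {a} {b} a≢b c = congruent λ j l → cong (λ v → v l) (same j)
    where
    same : ∀ j → replace₂ c a≢b (c a) (c b) j ≡ c j
    same j with j ≟ a | j ≟ b
    ... | yes refl | _        = replace₂-fst c a≢b _ _
    ... | no _     | yes refl = replace₂-snd c a≢b _ _
    ... | no j≢a   | no j≢b   = replace₂-other c a≢b _ _ j≢a j≢b

inject₁≢suc : (k : Fin n) → inject₁ k ≢ suc k
inject₁≢suc (suc k) eq = inject₁≢suc k (suc-injective eq)

-- The later of the two equal columns is moved left by adjacent swaps.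
detᶜ-equal-< : ∀ t (k : Fin n) → toℕ k ≡ t → (a : Fin (suc n)) → toℕ a ℕ.≤ toℕ k →
  (c : Vector (ℤⁿ (suc n)) (suc n)) → c a ≗ c (suc k) → detᶜ c ≡ 0ℤ
detᶜ-equal-< t k k≡t a a≤k c eq with a ≟ inject₁ k
... | yes refl = detᶜ-adjacent-equal k c eq
detᶜ-equal-< t zero k≡t zero a≤k c eq | no a≢k = contradiction refl a≢k
detᶜ-equal-< {suc n} (suc t) k@(suc k₀) k≡t a a≤k c eq | no a≢k = begin
  detᶜ c                  ≡⟨ +-identityʳ (detᶜ c) ⟨
  detᶜ c + 0ℤ             ≡⟨ cong (_+_ (detᶜ c)) swapped≡0 ⟨
  detᶜ c + detᶜ swapped   ≡⟨ cong (_+ detᶜ swapped) (replace₂-self {f = detᶜ} detᶜ-multilinear k≢ c) ⟨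
  detᶜ (replace₂ c k≢ (c (inject₁ k)) (c (suc k))) + detᶜ swapped
    ≡⟨ alternating⇒antisymmetric {f = detᶜ} detᶜ-multilinear k≢ (detᶜ-adjacent-equal k) c _ _ ⟩
  0ℤ ∎
  where
  open ≡-Reasoning
  k≢ = inject₁≢suc k
  swapped = replace₂ c k≢ (c (suc k)) (c (inject₁ k))

  toℕa≢ : toℕ a ≢ toℕ k
  toℕa≢ p = a≢k (toℕ-injective (trans p (sym (toℕ-inject₁ k))))

  a≢suck : a ≢ suc k
  a≢suck p = ℕₚ.1+n≰n (ℕₚ.≤-trans (ℕₚ.≤-reflexive (sym (cong toℕ p))) a≤k)

  swapped≡0 : detᶜ swapped ≡ 0ℤ
  -- `inject₁ k₀` is not a subterm of k; the recursion descends on t, the numerical value of k.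
  swapped≡0 = detᶜ-equal-< t (inject₁ k₀)
    (trans (toℕ-inject₁ k₀) (ℕₚ.suc-injective k≡t)) a
    (ℕₚ.≤-trans (ℕₚ.≤-pred (ℕₚ.≤∧≢⇒< a≤k toℕa≢)) (ℕₚ.≤-reflexive (sym (toℕ-inject₁ k₀)))) swapped λ l → begin
    swapped a l           ≡⟨ cong (λ v → v l) (replace₂-other c k≢ _ _ a≢k a≢suck) ⟩
    c a l                 ≡⟨ eq l ⟩
    c (suc k) l           ≡⟨ cong (λ v → v l) (replace₂-fst c k≢ _ _) ⟨
    swapped (inject₁ k) l ∎

detᶜ-alternating : {a b : Fin n} → a ≢ b → (c : Vector (ℤⁿ n) n) → c a ≗ c b → detᶜ c ≡ 0ℤ
detᶜ-alternating {suc n} {a} {b} a≢b c eq with ℕₚ.<-cmp (toℕ a) (toℕ b)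
detᶜ-alternating {suc n} {a} {suc b} a≢b c eq | tri< a<b _ _ = detᶜ-equal-< (toℕ b) b refl a (ℕₚ.≤-pred a<b) c eq
detᶜ-alternating {suc n} {a} {b} a≢b c eq | tri≈ _ a≡b _ = contradiction (toℕ-injective a≡b) a≢b
detᶜ-alternating {suc n} {suc a} {b} a≢b c eq | tri> _ _ b<a = detᶜ-equal-< (toℕ a) a refl b (ℕₚ.≤-pred b<a) c (sym ∘ eq)

-- Multilinear functions on spans

-- An inductive closure instead of a coefficient vector: properties stable under combinations follow
-- by recursion on the derivation. `respects` is there because vectors are functions compared
-- pointwise.
data Span {m n} (w : Vector (ℤⁿ n) m) : ℤⁿ n → Set where
  generator : ∀ j → Span w (w j)
  null      : Span w (λ _ → 0ℤ)
  combine   : ∀ a b {x y} → Span w x → Span w y → Span w (λ i → a * x i + b * y i)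
  respects  : ∀ {x y} → x ≗ y → Span w x → Span w y

multilinear-tail : {f : Vector (ℤⁿ n) (suc k) → ℤ} → Multilinear f → ∀ v → Multilinear (λ c → f (v ∷ᵛ c))
multilinear-tail {f = f} f-multilinear v = record
  { congruent = λ c≗c′ → congruent λ { zero l → refl ; (suc j) l → c≗c′ j l }
  ; linear = λ i a b off at → linear (suc i) a b
      (λ { zero _ → (λ _ → refl) , (λ _ → refl) ; (suc j) j≢i → off j (j≢i ∘ cong suc) })
      at
  }
  where open Multilinear f-multilinear

-- Freeze all columns but the first: divisibility of the value passes through combinations, so the
-- first column may be taken to be a generator. Fixing it there leaves a multilinear function of one
-- column fewer.
∣-multilinear : ∀ {K} {w : Vector (ℤⁿ n) m} {f : Vector (ℤⁿ n) k → ℤ} → Multilinear f →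
  (∀ (σ : Fin k → Fin m) → K ∣ f (w ∘ σ)) → ∀ c → (∀ j → Span w (c j)) → K ∣ f c
∣-multilinear {k = zero} {K} {w} {f} f-multilinear K∣ c c∈ =
  subst (K ∣_) (congruent λ ()) (K∣ λ ())
  where open Multilinear f-multilinear
∣-multilinear {n} {m} {k = suc k} {K} {w} {f} f-multilinear K∣ c c∈ =
  subst (K ∣_) (congruent λ { zero l → refl ; (suc j) l → refl }) (on-span (c∈ zero))
  where
  open Multilinear f-multilinear
  f₀ = λ v → f (v ∷ᵛ tail c)

  linear₀ : ∀ a b x y → f₀ (λ i → a * x i + b * y i) ≡ a * f₀ x + b * f₀ y
  linear₀ a b x y = linear zero a b
    (λ { zero 0≢0 → contradiction refl 0≢0 ; (suc j) _ → (λ _ → refl) , (λ _ → refl) }) (λ _ → refl)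

  on-span : ∀ {v} → Span w v → K ∣ f₀ v
  on-span (generator i) = ∣-multilinear (multilinear-tail {f = f} f-multilinear (w i))
    (λ σ → subst (K ∣_) (congruent λ { zero l → refl ; (suc j) l → refl }) (K∣ (i ∷ᵛ σ)))
    (tail c) (c∈ ∘ suc)
  -- The zero vector is the combination with both coefficients 0; products with 0ℤ on the left
  -- compute to 0ℤ.
  on-span null = divides 0ℤ (linear₀ 0ℤ 0ℤ (λ _ → 0ℤ) (λ _ → 0ℤ))
  on-span (combine a b {x} {y} x∈ y∈) = subst (K ∣_) (sym (linear₀ a b x y))
    (∣m∣n⇒∣m+n (∣n⇒∣m*n a (on-span x∈)) (∣n⇒∣m*n b (on-span y∈)))
  on-span (respects x≗y x∈) = subst (K ∣_) (congruent λ { zero l → x≗y l ; (suc j) l → refl }) (on-span x∈)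

multilinear-scale : {f : Vector (ℤⁿ n) k → ℤ} → Multilinear f →
  ∀ t c → f (λ j i → t j * c j i) ≡ product t * f c
multilinear-scale {k = zero} {f} f-multilinear t c = trans (congruent λ ()) (sym (*-identityˡ (f c)))
  where open Multilinear f-multilinear
multilinear-scale {k = suc k} {f} f-multilinear t c = begin
  f (λ j i → t j * c j i)
    ≡⟨ congruent (λ { zero l → refl ; (suc j) l → refl }) ⟩
  f ((λ i → t zero * c zero i) ∷ᵛ λ j i → t (suc j) * c (suc j) i)
    ≡⟨ multilinear-scale (multilinear-tail {f = f} f-multilinear _) (tail t) (tail c) ⟩
  product (tail t) * f ((λ i → t zero * c zero i) ∷ᵛ tail c)
    ≡⟨ cong (product (tail t) *_) (linear zero (t zero) 0ℤ {c} {c}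
         (λ { zero 0≢0 → contradiction refl 0≢0 ; (suc j) _ → (λ _ → refl) , (λ _ → refl) })
         (λ l → sym (+-identityʳ _))) ⟩
  product (tail t) * (t zero * f c + 0ℤ * f c)
    ≡⟨ rearrange (product (tail t)) (t zero) (f c) ⟩
  t zero * product (tail t) * f c ∎
  where
  open Multilinear f-multilinear
  open ≡-Reasoning
  rearrange : ∀ p s x → p * (s * x + 0ℤ * x) ≡ s * p * x
  rearrange = solve-∀

-- Pigeonhole: a missed value i could be punched out, giving an injection from `Fin (suc n)` into
-- `Fin n`.
injective⇒surjective : {σ : Fin n → Fin n} → Injective _≡_ _≡_ σ → ∀ i → ∃ λ j → σ j ≡ i
injective⇒surjective {suc n} {σ} σ-injective i with any? (λ j → σ j ≟ i)
... | yes found = found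
... | no ¬found = contradiction
  (injective⇒≤ {f = λ j → punchOut (missed j)} λ eq → σ-injective (punchOut-injective (missed _) (missed _) eq))
  ℕₚ.1+n≰n
  where
  missed : ∀ j → i ≢ σ j
  missed j i≡σj = ¬found (j , sym i≡σj)

product-injective : {σ : Fin n → Fin n} → Injective _≡_ _≡_ σ → ∀ t → product (t ∘ σ) ≡ product t
product-injective {σ = σ} σ-injective t = sym (product-permute t
  (permutation σ σ⁻¹ (λ i → proj₂ (surjective i)) (λ j → σ-injective (proj₂ (surjective (σ j))))))
  where
  surjective = injective⇒surjective σ-injective
  σ⁻¹ = proj₁ ∘ surjective

collision? : (σ : Fin n → Fin n) → (∃ λ i → ∃ λ j → i ≢ j × σ i ≡ σ j) ⊎ Injective _≡_ _≡_ σ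
collision? σ with any? (λ i → any? λ j → ¬? (i ≟ j) ×-dec (σ i ≟ σ j))
... | yes collision = inj₁ collision
... | no ¬collision = inj₂ λ {i} {j} eq → decidable-stable (i ≟ j) λ i≢j → ¬collision (i , j , i≢j , eq)

-- A choice σ of generators with a repetition gives two equal columns, hence 0. An injective σ is a
-- permutation, so the scalars pulled out of the columns multiply to `product E`.
product∣detᶜ : (E : Vector ℤ n) (p c : Vector (ℤⁿ n) n) →
  (∀ j → Span (λ i l → E i * p i l) (c j)) → product E ∣ detᶜ c
product∣detᶜ {n} E p c c∈ = ∣-multilinear {n} {f = detᶜ} detᶜ-multilinear on-generators c c∈
  where
  w : Vector (ℤⁿ n) n
  w i l = E i * p i l

  on-generators : ∀ σ → product E ∣ detᶜ (w ∘ σ)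
  on-generators σ with collision? σ
  ... | inj₁ (i , j , i≢j , eq) = divides 0ℤ (detᶜ-alternating i≢j (w ∘ σ) λ l → cong (λ q → w q l) eq)
  ... | inj₂ σ-injective = divides (detᶜ (p ∘ σ)) (begin
    detᶜ (w ∘ σ)                       ≡⟨ multilinear-scale {n} {f = detᶜ} detᶜ-multilinear (E ∘ σ) (p ∘ σ) ⟩
    product (E ∘ σ) * detᶜ (p ∘ σ)     ≡⟨ cong (_* detᶜ (p ∘ σ)) (product-injective σ-injective E) ⟩
    product E * detᶜ (p ∘ σ)           ≡⟨ *-comm (product E) _ ⟩
    detᶜ (p ∘ σ) * product E           ∎)
    where open ≡-Reasoning

-- Adapted bases of sublattices

record Linear {n k} (f : ℤⁿ n → ℤⁿ k) : Set where
  field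
    ≗-cong    : ∀ {x y} → x ≗ y → f x ≗ f y
    ∙-combine : ∀ a b x y → f (λ i → a * x i + b * y i) ≗ λ i → a * f x i + b * f y i

  ∙-null : f (λ _ → 0ℤ) ≗ λ _ → 0ℤ
  ∙-null = ∙-combine 0ℤ 0ℤ (λ _ → 0ℤ) (λ _ → 0ℤ)

-- A basis of ℤⁿ in disguise: `to` reads off coordinates and the vectors `from (unit i)` are the
-- basis. As a pair of maps it composes without matrix products.
record Automorphism (n : ℕ) : Set where
  field
    to from     : ℤⁿ n → ℤⁿ n
    to-linear   : Linear to
    from-linear : Linear from
    to∘from     : ∀ x → to (from x) ≗ x
    from∘to     : ∀ x → from (to x) ≗ x

  open Linear to-linear public renaming (≗-cong to to-cong; ∙-combine to to-combine; ∙-null to to-null)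
  open Linear from-linear public renaming (≗-cong to from-cong; ∙-combine to from-combine; ∙-null to from-null)

-- d i = 0 encodes a free coordinate, as 0 divides only 0.
record Adapted {n} (L : ℤⁿ n → Set) : Set where
  field
    automorphism : Automorphism n
    d            : Fin n → ℕ

  open Automorphism automorphism public

  field
    to-∣ : ∀ {x} → L x → ∀ i → + d i ∣ to x i
    ∣-to : ∀ {x} → (∀ i → + d i ∣ to x i) → L x

adapted-⇔ : {L L′ : ℤⁿ n → Set} → (∀ {x} → L x → L′ x) → (∀ {x} → L′ x → L x) → Adapted L → Adapted L′
adapted-⇔ L⊆L′ L′⊆L A = record
  { automorphism = automorphism
  ; d = d
  ; to-∣ = λ x∈ → to-∣ (L′⊆L x∈)
  ; ∣-to = λ d∣ → L⊆L′ (∣-to d∣)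
  }
  where open Adapted A

span-⊆ : {v : Vector (ℤⁿ n) k} {w : Vector (ℤⁿ n) m} → (∀ j → Span w (v j)) → ∀ {x} → Span v x → Span w x
span-⊆ v⊆ (generator j)        = v⊆ j
span-⊆ v⊆ null                 = null
span-⊆ v⊆ (combine a b x∈ y∈)  = combine a b (span-⊆ v⊆ x∈) (span-⊆ v⊆ y∈)
span-⊆ v⊆ (respects x≗y x∈)    = respects x≗y (span-⊆ v⊆ x∈)

span-map : {f : ℤⁿ n → ℤⁿ k} → Linear f → {w : Vector (ℤⁿ n) m} → ∀ {x} → Span w x → Span (f ∘ w) (f x)
span-map f-linear (generator j) = generator j
span-map f-linear null = respects (sym ∘ ∙-null) null
  where open Linear f-linear
span-map f-linear (combine a b {x} {y} x∈ y∈) = respects (sym ∘ ∙-combine a b x y)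
  (combine a b (span-map f-linear x∈) (span-map f-linear y∈))
  where open Linear f-linear
span-map f-linear (respects x≗y x∈) = respects (≗-cong x≗y) (span-map f-linear x∈)
  where open Linear f-linear

-- A column operation on the matrix with rows `w j`. Its coordinate change composes with the one
-- found for the transformed generators, and `d` stays as it is.
adapted-pullback : (φ : Automorphism n) (w : Vector (ℤⁿ n) m) → Adapted (Span (Automorphism.to φ ∘ w)) → Adapted (Span w)
adapted-pullback φ w A = record
  { automorphism = record
    { to          = A.to ∘ to
    ; from        = from ∘ A.from
    ; to-linear   = record
      { ≗-cong = A.to-cong ∘ to-cong
      ; ∙-combine = λ a b x y i → trans (A.to-cong (to-combine a b x y) i) (A.to-combine a b (to x) (to y) i)
      }
    ; from-linear = record
      { ≗-cong = from-cong ∘ A.from-cong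
      ; ∙-combine = λ a b x y i → trans (from-cong (A.from-combine a b x y) i) (from-combine a b (A.from x) (A.from y) i)
      }
    ; to∘from     = λ x i → trans (A.to-cong (to∘from (A.from x)) i) (A.to∘from x i)
    ; from∘to     = λ x i → trans (from-cong (A.from∘to (to x)) i) (from∘to x i)
    }
  ; d = A.d
  ; to-∣ = A.to-∣ ∘ span-map to-linear
  ; ∣-to = λ {x} d∣ → respects (from∘to x)
      (span-⊆ (λ j → respects (sym ∘ from∘to (w j)) (generator j)) (span-map from-linear (A.∣-to d∣)))
  }
  where
  module A = Adapted A
  open Automorphism φ

identity : Automorphism n
identity = record
  { to          = id
  ; from        = id
  ; to-linear   = id-linear
  ; from-linear = id-linear
  ; to∘from     = λ _ _ → refl
  ; from∘to     = λ _ _ → refl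
  }
  where
  id-linear : Linear id
  id-linear = record { ≗-cong = id ; ∙-combine = λ _ _ _ _ _ → refl }

permute : Permutation n n → Automorphism n
permute π = record
  { to          = _∘ (π ⟨$⟩ʳ_)
  ; from        = _∘ (π ⟨$⟩ˡ_)
  ; to-linear   = record { ≗-cong = λ x≗y i → x≗y _ ; ∙-combine = λ _ _ _ _ _ → refl }
  ; from-linear = record { ≗-cong = λ x≗y i → x≗y _ ; ∙-combine = λ _ _ _ _ _ → refl }
  ; to∘from     = λ x i → cong x (inverseˡ π)
  ; from∘to     = λ x i → cong x (inverseʳ π)
  }

span-permute : (π : Permutation m m) (w : Vector (ℤⁿ n) m) → ∀ {x} → Span w x → Span (w ∘ (π ⟨$⟩ʳ_)) x
span-permute π w = span-⊆ λ j → subst (λ q → Span (w ∘ (π ⟨$⟩ʳ_)) (w q)) (inverseʳ π) (generator (π ⟨$⟩ˡ j))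

shear : Vector ℤ n → ℤⁿ (suc n) → ℤⁿ (suc n)
shear q x zero    = x zero
shear q x (suc i) = x (suc i) - q i * x zero

shear-linear : (q : Vector ℤ n) → Linear (shear q)
shear-linear q = record
  { ≗-cong = λ { x≗y zero → x≗y zero ; x≗y (suc i) → cong₂ (λ s t → s - q i * t) (x≗y (suc i)) (x≗y zero) }
  ; ∙-combine = λ { a b x y zero → refl ; a b x y (suc i) → rearrange a b (q i) (x (suc i)) (y (suc i)) (x zero) (y zero) }
  }
  where
  rearrange : ∀ a b q x y x₀ y₀ → a * x + b * y - q * (a * x₀ + b * y₀) ≡ a * (x - q * x₀) + b * (y - q * y₀)
  rearrange = solve-∀

shearing : Vector ℤ n → Automorphism (suc n)
shearing q = record
  { to          = shear q
  ; from        = shear (-_ ∘ q)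
  ; to-linear   = shear-linear q
  ; from-linear = shear-linear (-_ ∘ q)
  ; to∘from     = λ { x zero → refl ; x (suc i) → there (x (suc i)) (q i) (x zero) }
  ; from∘to     = λ { x zero → refl ; x (suc i) → back (x (suc i)) (q i) (x zero) }
  }
  where
  there : ∀ x q y → x - (- q) * y - q * y ≡ x
  there = solve-∀
  back : ∀ x q y → x - q * y - (- q) * y ≡ x
  back = solve-∀

-- The row operation matching `shear`: it alters the generating family but not the lattice, so it
-- leaves no trace in the coordinates.
shear-generators : Vector ℤ m → Vector (ℤⁿ n) (suc m) → Vector (ℤⁿ n) (suc m)
shear-generators p w zero    i = w zero i
shear-generators p w (suc j) i = w (suc j) i - p j * w zero i

module _ (p : Vector ℤ m) (w : Vector (ℤⁿ n) (suc m)) where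

  span-shear : ∀ {x} → Span w x → Span (shear-generators p w) x
  span-shear = span-⊆ λ
    { zero    → generator zero
    ; (suc j) → respects (λ i → rearrange (w (suc j) i) (p j) (w zero i)) (combine 1ℤ (p j) (generator (suc j)) (generator zero)) }
    where
    rearrange : ∀ x p y → 1ℤ * (x - p * y) + p * y ≡ x
    rearrange = solve-∀

  span-unshear : ∀ {x} → Span (shear-generators p w) x → Span w x
  span-unshear = span-⊆ λ
    { zero    → generator zero
    ; (suc j) → respects (λ i → rearrange (w (suc j) i) (p j) (w zero i)) (combine 1ℤ (- p j) (generator (suc j)) (generator zero)) }
    where
    rearrange : ∀ x p y → 1ℤ * x + - p * y ≡ x - p * y
    rearrange = solve-∀

adapted-zero : (w : Vector (ℤⁿ n) m) → (∀ j i → w j i ≡ 0ℤ) → Adapted (Span w)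
adapted-zero w w≡0 = record
  { automorphism = identity
  ; d = const 0
  ; to-∣ = λ x∈ i → divides 0ℤ (span-zero x∈ i)
  ; ∣-to = λ 0∣ → respects (λ i → sym (0∣⇒≡0 (0∣ i))) null
  }
  where
  span-zero : ∀ {x} → Span w x → ∀ i → x i ≡ 0ℤ
  span-zero (generator j)            i = w≡0 j i
  span-zero null                     i = refl
  span-zero (combine a b x∈ y∈)      i = cong₂ _+_
    (trans (cong (a *_) (span-zero x∈ i)) (*-zeroʳ a)) (trans (cong (b *_) (span-zero y∈ i)) (*-zeroʳ b))
  span-zero (respects x≗y x∈)        i = trans (sym (x≗y i)) (span-zero x∈ i)

submatrix : Vector (ℤⁿ (suc n)) (suc m) → Vector (ℤⁿ n) m
submatrix w j i = w (suc j) (suc i)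

-- With a pivot alone in its row and column, the lattice is the direct sum of the multiples of the
-- pivot in coordinate zero and the span of the submatrix in the others.
adapted-block : (w : Vector (ℤⁿ (suc n)) (suc m)) →
  (∀ i → w zero (suc i) ≡ 0ℤ) → (∀ j → w (suc j) zero ≡ 0ℤ) →
  Adapted (Span (submatrix w)) → Adapted (Span w)
adapted-block {n} w row≡0 column≡0 A = record
  { automorphism = record
    { to          = extend A.to
    ; from        = extend A.from
    ; to-linear   = extend-linear A.to-linear
    ; from-linear = extend-linear A.from-linear
    ; to∘from     = λ { x zero → refl ; x (suc i) → A.to∘from (tail x) i }
    ; from∘to     = λ { x zero → refl ; x (suc i) → A.from∘to (tail x) i }
    }
  ; d = ∣ w zero zero ∣ ∷ᵛ A.d
  ; to-∣ = λ { x∈ zero → ∣-trans ∣m∣∣m (head-∣ x∈) ; x∈ (suc i) → A.to-∣ (tail-span x∈) i }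
  ; ∣-to = λ d∣ → from-parts (∣-trans m∣∣m∣ (d∣ zero)) (A.∣-to (d∣ ∘ suc))
  }
  where
  module A = Adapted A
  a = w zero zero

  extend : (ℤⁿ n → ℤⁿ n) → ℤⁿ (suc n) → ℤⁿ (suc n)
  extend f x = x zero ∷ᵛ f (tail x)

  extend-linear : ∀ {f} → Linear f → Linear (extend f)
  extend-linear f-linear = record
    { ≗-cong = λ { x≗y zero → x≗y zero ; x≗y (suc i) → ≗-cong (x≗y ∘ suc) i }
    ; ∙-combine = λ { a b x y zero → refl ; a b x y (suc i) → ∙-combine a b (tail x) (tail y) i }
    }
    where open Linear f-linear

  head-∣ : ∀ {x} → Span w x → a ∣ x zero
  head-∣ (generator zero)     = ∣-refl
  head-∣ (generator (suc j))  = divides 0ℤ (column≡0 j)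
  head-∣ null                 = divides 0ℤ refl
  head-∣ (combine b c x∈ y∈)  = ∣m∣n⇒∣m+n (∣n⇒∣m*n b (head-∣ x∈)) (∣n⇒∣m*n c (head-∣ y∈))
  head-∣ (respects x≗y x∈)    = subst (a ∣_) (x≗y zero) (head-∣ x∈)

  tail-span : ∀ {x} → Span w x → Span (submatrix w) (tail x)
  tail-span (generator zero)     = respects (sym ∘ row≡0) null
  tail-span (generator (suc j))  = generator j
  tail-span null                 = null
  tail-span (combine b c x∈ y∈)  = combine b c (tail-span x∈) (tail-span y∈)
  tail-span (respects x≗y x∈)    = respects (x≗y ∘ suc) (tail-span x∈)

  0∷-linear : Linear {n} (0ℤ ∷ᵛ_)
  0∷-linear = record
    { ≗-cong = λ { x≗y zero → refl ; x≗y (suc i) → x≗y i }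
    ; ∙-combine = λ { a b x y zero → sym (cong₂ _+_ (*-zeroʳ a) (*-zeroʳ b)) ; a b x y (suc i) → refl }
    }

  from-parts : ∀ {x} → a ∣ x zero → Span (submatrix w) (tail x) → Span w x
  from-parts {x} (divides q x₀≡q*a) tail∈ = respects
    (λ { zero    → trans (+-identityʳ (q * a)) (sym x₀≡q*a)
       ; (suc i) → trans (cong₂ _+_ (trans (cong (q *_) (row≡0 i)) (*-zeroʳ q)) (*-identityˡ (x (suc i)))) (+-identityˡ _) })
    (combine q 1ℤ (generator zero) (span-⊆
      (λ j → respects (λ { zero → column≡0 j ; (suc i) → refl }) (generator (suc j)))
      (span-map 0∷-linear tail∈)))

x-[x/a]*a : ∀ x a .{{_ : NonZero a}} → x - (x / a) * a ≡ + (x % a)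
x-[x/a]*a x a = trans (cong (_- (x / a) * a) (a≡a%n+[a/n]*n x a)) (cancel (+ (x % a)) ((x / a) * a))
  where
  cancel : ∀ r s → r + s - s ≡ r
  cancel = solve-∀

-- Reduce the first row and column modulo the pivot; a nonzero remainder is a smaller pivot.
adapted-pivot : (∀ {m} (w : Vector (ℤⁿ n) m) → Adapted (Span w)) →
  (w : Vector (ℤⁿ (suc n)) (suc m)) → w zero zero ≢ 0ℤ → Acc ℕ._<_ ∣ w zero zero ∣ → Adapted (Span w)
adapted-pivot {n} {m} adapted w a≢0 (acc smaller) =
  adapted-pullback (shearing q) w (adapted-⇔ (span-unshear p w₁) (span-shear p w₁) adapted₂)
  where
  a = w zero zero
  instance
    a-nonZero : NonZero a
    a-nonZero = ≢-nonZero a≢0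

  q : Vector ℤ n
  q i = w zero (suc i) / a
  w₁ = shear q ∘ w

  -- `shear q` does not touch coordinate zero, so the original first column still determines these
  -- quotients.
  p : Vector ℤ m
  p j = w (suc j) zero / a
  w₂ = shear-generators p w₁

  row : ∀ i → w₂ zero (suc i) ≡ + (w zero (suc i) % a)
  row i = x-[x/a]*a (w zero (suc i)) a

  column : ∀ j → w₂ (suc j) zero ≡ + (w (suc j) zero % a)
  column j = x-[x/a]*a (w (suc j) zero) a

  remainder-< : ∀ x {y} → y ≡ + (x % a) → ∣ y ∣ ℕ.< ∣ a ∣
  remainder-< x refl = n%d<d x a

  adapted₂ : Adapted (Span w₂)
  adapted₂ with any? (λ i → ¬? (w₂ zero (suc i) ℤₚ.≟ 0ℤ)) | any? (λ j → ¬? (w₂ (suc j) zero ℤₚ.≟ 0ℤ))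
  -- The transposition moves the nonzero remainder into the corner as the new pivot.
  ... | yes (i , r≢0) | _ = adapted-pullback (permute π) w₂
    (adapted-pivot adapted (λ j i → w₂ j (π ⟨$⟩ʳ i)) r≢0 (smaller (remainder-< (w zero (suc i)) (row i))))
    where π = transpose zero (suc i)
  ... | no _ | yes (j , r≢0) = adapted-⇔ (span-⊆ λ j → generator (π ⟨$⟩ʳ j)) (span-permute π w₂)
    (adapted-pivot adapted (w₂ ∘ (π ⟨$⟩ʳ_)) r≢0 (smaller (remainder-< (w (suc j) zero) (column j))))
    where π = transpose zero (suc j)
  ... | no row≡0 | no column≡0 = adapted-block w₂
    (λ i → decidable-stable (_ ℤₚ.≟ _) λ ≢0 → row≡0 (i , ≢0))
    (λ j → decidable-stable (_ ℤₚ.≟ _) λ ≢0 → column≡0 (j , ≢0))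
    -- Both remainder vectors vanish, and the hypothesis for the smaller ambient dimension applies,
    -- whatever the number of generators.
    (adapted (submatrix w₂))

adapted-span : (w : Vector (ℤⁿ n) m) → Adapted (Span w)
adapted-span {zero} w = adapted-zero w λ _ ()
adapted-span {suc n} {zero} w = adapted-zero w λ ()
adapted-span {suc n} {suc m} w with any? (λ j → any? λ i → ¬? (w j i ℤₚ.≟ 0ℤ))
... | no w≡0 = adapted-zero w λ j i → decidable-stable (_ ℤₚ.≟ _) λ ≢0 → w≡0 (j , i , ≢0)
-- Any nonzero entry serves as the first pivot; a transposition of coordinates and one of generators
-- bring it to the corner.
... | yes (j , i , ≢0) = adapted-pullback (permute π) w
  (adapted-⇔ (span-⊆ λ j → generator (ρ ⟨$⟩ʳ j)) (span-permute ρ (λ j i → w j (π ⟨$⟩ʳ i)))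
    (adapted-pivot adapted-span (λ j i → w (ρ ⟨$⟩ʳ j) (π ⟨$⟩ʳ i)) ≢0 (<-wellFounded _)))
  where
  π = transpose zero i
  ρ = transpose zero j

-- Products of finite cyclic groups

∏ : Vector ℕ n → ℕ
∏ = foldr ℕ._*_ 1

-- Mixed-radix notation: the digits f i are written with the varying bases e i.
encode : (e : Vector ℕ n) → (∀ i → Fin (e i)) → Fin (∏ e)
encode {zero}  e f = zero
encode {suc n} e f = pair (f zero) (encode (tail e) (f ∘ suc))

decode : (e : Vector ℕ n) → Fin (∏ e) → ∀ i → Fin (e i)
decode e c zero    = proj₁ (remQuot {head e} (∏ (tail e)) c)
decode e c (suc i) = decode (tail e) (proj₂ (remQuot {head e} (∏ (tail e)) c)) i

encode-cong : (e : Vector ℕ n) {f g : ∀ i → Fin (e i)} → (∀ i → f i ≡ g i) → encode e f ≡ encode e g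
encode-cong {zero}  e f≗g = refl
encode-cong {suc n} e f≗g = cong₂ pair (f≗g zero) (encode-cong (tail e) (f≗g ∘ suc))

decode-encode : (e : Vector ℕ n) (f : ∀ i → Fin (e i)) → ∀ i → decode e (encode e f) i ≡ f i
decode-encode e f zero    = cong proj₁ (remQuot-combine (f zero) (encode (tail e) (f ∘ suc)))
decode-encode e f (suc i) = trans
  (cong (λ c → decode (tail e) (proj₂ c) i) (remQuot-combine (f zero) (encode (tail e) (f ∘ suc))))
  (decode-encode (tail e) (f ∘ suc) i)

encode-decode : (e : Vector ℕ n) (c : Fin (∏ e)) → encode e (decode e c) ≡ c
encode-decode {zero}  e zero = refl
encode-decode {suc n} e c = trans
  (cong (pair (decode e c zero)) (encode-decode (tail e) _))
  (combine-remQuot {head e} (∏ (tail e)) c)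

∣∏ : (e : Vector ℕ n) → ∀ i → + e i ∣ + ∏ e
∣∏ e zero    = subst (+ head e ∣_) (sym (pos-* (head e) (∏ (tail e)))) (∣m⇒∣m*n (+ ∏ (tail e)) ∣-refl)
∣∏ e (suc i) = subst (+ e (suc i) ∣_) (sym (pos-* (head e) (∏ (tail e)))) (∣n⇒∣m*n (+ head e) (∣∏ (tail e) i))

∏-nonZero : (e : Vector ℕ n) → (∀ i → ℕ.NonZero (e i)) → ℕ.NonZero (∏ e)
∏-nonZero {zero}  e e≢0 = _
∏-nonZero {suc n} e e≢0 = ℕₚ.m*n≢0 (head e) (∏ (tail e)) {{e≢0 zero}} {{∏-nonZero (tail e) (e≢0 ∘ suc)}}

residue : ℤ → ∀ k .{{_ : ℕ.NonZero k}} → Fin k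
residue y k = fromℕ< (n%ℕd<d y k)

residue-∣ : ∀ y k .{{_ : ℕ.NonZero k}} → + k ∣ + toℕ (residue y k) - y
residue-∣ y k = divides (- (y /ℕ k)) (begin
  + toℕ (residue y k) - y                            ≡⟨ cong (λ r → + r - y) (toℕ-fromℕ< (n%ℕd<d y k)) ⟩
  + (y %ℕ k) - y                                     ≡⟨ cong (_-_ (+ (y %ℕ k))) (a≡a%ℕn+[a/ℕn]*n y k) ⟩
  + (y %ℕ k) - (+ (y %ℕ k) + (y /ℕ k) * + k)         ≡⟨ cancel (+ (y %ℕ k)) (y /ℕ k) (+ k) ⟩
  - (y /ℕ k) * + k                                   ∎)
  where
  open ≡-Reasoning
  cancel : ∀ r q k → r - (r + q * k) ≡ - q * k
  cancel = solve-∀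

-- Numbers below k differ by at most their maximum, which is too little for a nonzero multiple of k.
∣-small⇒≡ : ∀ {k a b} → a ℕ.< k → b ℕ.< k → + k ∣ + a - + b → a ≡ b
∣-small⇒≡ {k} {a} {b} a<k b<k k∣ with + a - + b ℤₚ.≟ 0ℤ
... | yes a-b≡0 = +-injective (i-j≡0⇒i≡j (+ a) (+ b) a-b≡0)
... | no a-b≢0 = contradiction (ℕ∣.∣⇒≤ {{≢-nonZero a-b≢0}} (∣⇒∣ᵤ k∣)) (ℕₚ.<⇒≱ (begin-strict
  ∣ + a - + b ∣  ≡⟨ cong ∣_∣ (m-n≡m⊖n a b) ⟩
  ∣ a ⊖ b ∣      ≤⟨ ∣m⊝n∣≤m⊔n a b ⟩
  a ℕ.⊔ b        <⟨ ℕₚ.⊔-pres-<m a<k b<k ⟩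
  k              ∎))
  where open ℕₚ.≤-Reasoning

residue-cong : ∀ {y y′} k .{{_ : ℕ.NonZero k}} → + k ∣ y - y′ → residue y k ≡ residue y′ k
residue-cong {y} {y′} k k∣ = toℕ-injective (∣-small⇒≡ (toℕ<n _) (toℕ<n _)
  (subst (+ k ∣_) (telescope (+ toℕ (residue y k)) y y′ (+ toℕ (residue y′ k)))
    (∣m∣n⇒∣m-n (∣m∣n⇒∣m+n (residue-∣ y k) k∣) (residue-∣ y′ k))))
  where
  telescope : ∀ r y y′ r′ → r - y + (y - y′) - (r′ - y′) ≡ r - r′
  telescope = solve-∀

residue-toℕ : ∀ {k} .{{_ : ℕ.NonZero k}} (c : Fin k) → residue (+ toℕ c) k ≡ c
residue-toℕ {k} c = toℕ-injective (trans (toℕ-fromℕ< (n%ℕd<d (+ toℕ c) k)) (m<n⇒m%n≡m (toℕ<n c)))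

-- Linear dependence over ℤ

isZero : ℕ → ℕ
isZero zero    = 1
isZero (suc _) = 0

zeros : Vector ℕ n → ℕ
zeros = foldr (λ x z → isZero x ℕ.+ z) 0

-- Only the free coordinates impose conditions; the others are dealt with by multiplying all
-- coefficients by the torsion order.
Relation : Vector ℕ n → Vector (ℤⁿ n) k → Set
Relation {k = k} d y = ∃ λ (a : Vector ℤ k) → (∃ λ j → a j ≢ 0ℤ) × ∀ i → d i ≡ 0 → sum (λ j → a j * y j i) ≡ 0ℤ

-- A division-free Gaussian step with pivot vector y j. The combination has coordinate zero equal to
-- 0, so that coordinate is dropped.
eliminate : (y : Vector (ℤⁿ (suc n)) (suc k)) (j : Fin (suc k)) → Vector (ℤⁿ n) k
eliminate y j l i = y j zero * y (punchIn j l) (suc i) - y (punchIn j l) zero * y j (suc i)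

relation-eliminate : (d : Vector ℕ (suc n)) (y : Vector (ℤⁿ (suc n)) (suc k)) (j : Fin (suc k)) →
  y j zero ≢ 0ℤ → Relation (tail d) (eliminate y j) → Relation d y
relation-eliminate {n} {k} d y j c≢0 (a , (l , al≢0) , a-relation) = b , (punchIn j l , b≢0) , b-relation
  where
  open ≡-Reasoning
  c = y j zero
  -- The coefficient of the pivot vector, obtained by expanding the sum of the a l times the
  -- eliminated vectors and collecting the multiples of y j.
  v = - sum (λ l → a l * y (punchIn j l) zero)
  b = insertAt (λ l → c * a l) j v

  b≢0 : b (punchIn j l) ≢ 0ℤ
  b≢0 eq = al≢0 (*-cancelˡ-≡ c (a l) 0ℤ {{≢-nonZero c≢0}} (trans (trans (sym (insertAt-punchIn _ j v l)) eq) (sym (*-zeroʳ c))))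

  rearrange : ∀ c a y Y z → a * (c * y - z * Y) ≡ 1ℤ * (c * a * y) + (- Y) * (a * z)
  rearrange = solve-∀

  rearrange′ : ∀ s t Y → (- t) * Y + s ≡ 1ℤ * s + (- Y) * t
  rearrange′ = solve-∀

  combination : ∀ i → sum (λ q → b q * y q i) ≡ sum (λ l → a l * (c * y (punchIn j l) i - y (punchIn j l) zero * y j i))
  combination i = begin
    sum (λ q → b q * y q i)
      ≡⟨ sum-remove {i = j} (λ q → b q * y q i) ⟩
    b j * y j i + sum (λ l → b (punchIn j l) * y (punchIn j l) i)
      ≡⟨ cong₂ _+_ (cong (_* y j i) (insertAt-lookup _ j v))
           (sum-cong-≗ λ l → cong (_* y (punchIn j l) i) (insertAt-punchIn _ j v l)) ⟩
    v * y j i + sum (λ l → c * a l * y (punchIn j l) i)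
      ≡⟨ rearrange′ (sum λ l → c * a l * y (punchIn j l) i) (sum λ l → a l * y (punchIn j l) zero) (y j i) ⟩
    1ℤ * sum (λ l → c * a l * y (punchIn j l) i) + (- y j i) * sum (λ l → a l * y (punchIn j l) zero)
      ≡⟨ sum-linear 1ℤ (- y j i) (λ l → c * a l * y (punchIn j l) i) (λ l → a l * y (punchIn j l) zero) ⟨
    sum (λ l → 1ℤ * (c * a l * y (punchIn j l) i) + (- y j i) * (a l * y (punchIn j l) zero))
      ≡⟨ sum-cong-≗ (λ l → rearrange c (a l) (y (punchIn j l) i) (y j i) (y (punchIn j l) zero)) ⟨
    sum (λ l → a l * (c * y (punchIn j l) i - y (punchIn j l) zero * y j i)) ∎

  vanish : ∀ a c z → a * (c * z - z * c) ≡ 0ℤ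
  vanish = solve-∀

  b-relation : ∀ i → d i ≡ 0 → sum (λ q → b q * y q i) ≡ 0ℤ
  b-relation zero    _    = trans (combination zero) (sum-zero _ λ l → vanish (a l) c (y (punchIn j l) zero))
  b-relation (suc i) di≡0 = trans (combination (suc i)) (a-relation i di≡0)

-- Induction on the coordinates. A coordinate with nonzero d is skipped; a free one either supplies
-- a pivot, costing one vector and one zero of d, or vanishes on all vectors and imposes nothing.
-- With no coordinates left, any coefficients will do.
zeros<⇒relation : (d : Vector ℕ n) (y : Vector (ℤⁿ n) k) → zeros d ℕ.< k → Relation d y
zeros<⇒relation {zero} {suc k} d y _ = const 1ℤ , (zero , λ ()) , λ ()
zeros<⇒relation {suc n} {k} d y z<k with d zero in d₀
... | suc _ with zeros<⇒relation (tail d) (tail ∘ y) z<k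
...   | a , a≢0 , a-relation = a , a≢0 , λ
  { zero d₀≡0 → contradiction (trans (sym d₀) d₀≡0) λ () ; (suc i) → a-relation i }
zeros<⇒relation {suc n} {suc k} d y z<k | zero with any? (λ j → ¬? (y j zero ℤₚ.≟ 0ℤ))
... | yes (j , c≢0) = relation-eliminate d y j c≢0 (zeros<⇒relation (tail d) (eliminate y j) (ℕₚ.≤-pred z<k))
... | no y₀≡0 with zeros<⇒relation (tail d) (tail ∘ y) (ℕₚ.<-trans (ℕₚ.n<1+n _) z<k)
...   | a , a≢0 , a-relation = a , a≢0 , λ
  { zero _ → sum-zero _ λ j → trans (cong (a j *_) (decidable-stable (y j zero ℤₚ.≟ 0ℤ) λ ≢0 → y₀≡0 (j , ≢0))) (*-zeroʳ (a j))
  ; (suc i) → a-relation i }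

-- Evaluation of polynomials

eval : ℤ[u] → ℤ → ℤ
eval []      x = 0ℤ
eval (a ∷ p) x = a + x * eval p x

eval-+ : ∀ p q x → eval (p +ₚ q) x ≡ eval p x + eval q x
eval-+ []      q       x = sym (+-identityˡ (eval q x))
eval-+ (a ∷ p) []      x = sym (+-identityʳ (eval (a ∷ p) x))
eval-+ (a ∷ p) (b ∷ q) x = trans (cong (λ t → a + b + x * t) (eval-+ p q x)) (rearrange a b x (eval p x) (eval q x))
  where
  rearrange : ∀ a b x s t → a + b + x * (s + t) ≡ a + x * s + (b + x * t)
  rearrange = solve-∀

eval-scale : ∀ a p x → eval (List.map (a *_) p) x ≡ a * eval p x
eval-scale a []      x = sym (*-zeroʳ a)
eval-scale a (b ∷ p) x = trans (cong (λ t → a * b + x * t) (eval-scale a p x)) (rearrange a b x (eval p x))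
  where
  rearrange : ∀ a b x s → a * b + x * (a * s) ≡ a * (b + x * s)
  rearrange = solve-∀

eval-* : ∀ p q x → eval (p *ₚ q) x ≡ eval p x * eval q x
eval-* []      q x = refl
eval-* (a ∷ p) q x = begin
  eval (List.map (a *_) q +ₚ (0ℤ ∷ p *ₚ q)) x             ≡⟨ eval-+ (List.map (a *_) q) (0ℤ ∷ p *ₚ q) x ⟩
  eval (List.map (a *_) q) x + (0ℤ + x * eval (p *ₚ q) x)
    ≡⟨ cong₂ (λ s t → s + (0ℤ + x * t)) (eval-scale a q x) (eval-* p q x) ⟩
  a * eval q x + (0ℤ + x * (eval p x * eval q x))         ≡⟨ rearrange a x (eval p x) (eval q x) ⟩
  (a + x * eval p x) * eval q x                           ∎
  where
  open ≡-Reasoning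
  rearrange : ∀ a x p q → a * q + (0ℤ + x * (p * q)) ≡ (a + x * p) * q
  rearrange = solve-∀

eval-neg : ∀ p x → eval (-ₚ p) x ≡ - eval p x
eval-neg []      x = refl
eval-neg (a ∷ p) x = trans (cong (λ t → - a + x * t) (eval-neg p x)) (rearrange a x (eval p x))
  where
  rearrange : ∀ a x s → - a + x * (- s) ≡ - (a + x * s)
  rearrange = solve-∀

eval-constant : ∀ a x → eval (constant a) x ≡ a
eval-constant a x = trans (cong (_+_ a) (*-zeroʳ x)) (+-identityʳ a)

eval-u : ∀ x → eval u x ≡ x
eval-u x = trans (+-identityˡ _) (trans (cong (x *_) (eval-constant 1ℤ x)) (*-identityʳ x))

eval-taylor : ∀ a p x → eval (taylor a p) x ≡ eval p (a + x)
eval-taylor a []      x = refl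
eval-taylor a (b ∷ p) x = begin
  eval (constant b +ₚ (a ∷ 1ℤ ∷ []) *ₚ taylor a p) x
    ≡⟨ eval-+ (constant b) ((a ∷ 1ℤ ∷ []) *ₚ taylor a p) x ⟩
  eval (constant b) x + eval ((a ∷ 1ℤ ∷ []) *ₚ taylor a p) x
    ≡⟨ cong₂ _+_ (eval-constant b x) (eval-* (a ∷ 1ℤ ∷ []) (taylor a p) x) ⟩
  b + (a + x * eval (constant 1ℤ) x) * eval (taylor a p) x
    ≡⟨ cong₂ (λ s t → b + (a + s) * t) (trans (cong (x *_) (eval-constant 1ℤ x)) (*-identityʳ x)) (eval-taylor a p x) ⟩
  b + (a + x) * eval p (a + x) ∎
  where open ≡-Reasoning

eval-sum : (t : Vector ℤ[u] n) → ∀ x → eval (ℤ[u]ʳ.sum t) x ≡ sum (λ i → eval (t i) x)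
eval-sum {zero}  t x = refl
eval-sum {suc n} t x = trans (eval-+ (head t) (ℤ[u]ʳ.sum (tail t)) x) (cong (_+_ (eval (head t) x)) (eval-sum (tail t) x))

eval-sign : ∀ k x → eval ((-ₚ (constant 1ℤ)) ℤ[u]ʳ.^ k) x ≡ (- 1ℤ) ℤʳ.^ k
eval-sign zero    x = eval-constant 1ℤ x
eval-sign (suc k) x = trans (eval-* (-ₚ (constant 1ℤ)) ((-ₚ (constant 1ℤ)) ℤ[u]ʳ.^ k) x)
  (cong₂ _*_ (eval-constant (- 1ℤ) x) (eval-sign k x))

eval-det : (M : Fin n → Fin n → ℤ[u]) → ∀ x → eval (det ℤ[u]-rawRing M) x ≡ detℤ (λ i j → eval (M i j) x)
eval-det {zero}  M x = eval-constant 1ℤ x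
eval-det {suc n} M x = trans (eval-sum {suc n} (λ j → sgn j *ₚ (M zero j *ₚ cofactor j)) x) (sum-cong-≗ {suc n} λ j →
  trans (eval-* (sgn j) (M zero j *ₚ cofactor j) x) (cong₂ _*_ (eval-sign (toℕ j) x)
    (trans (eval-* (M zero j) (cofactor j) x)
      (cong (eval (M zero j) x *_) (eval-det (λ i k → M (suc i) (punchIn j k)) x)))))
  where
  sgn cofactor : Fin (suc n) → ℤ[u]
  sgn j      = (-ₚ (constant 1ℤ)) ℤ[u]ʳ.^ toℕ j
  cofactor j = det ℤ[u]-rawRing λ i k → M (suc i) (punchIn j k)

-- Applied to the Taylor list at 1 with x = N, this is the factorisation of g(1 + N); t is the value
-- of what follows the leading coefficient.
eval-leading : ∀ p x → ∃ λ t → eval p x ≡ x ^ leadingZeros p * (coeff p (leadingZeros p) + x * t)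
eval-leading [] x = 0ℤ , sym (trans (*-identityˡ _) (trans (+-identityˡ _) (*-zeroʳ x)))
eval-leading (b ∷ p) x with b ℤₚ.≟ 0ℤ
... | no _ = eval p x , sym (*-identityˡ _)
... | yes refl with eval-leading p x
...   | t , eq = t , trans (+-identityˡ _) (trans (cong (x *_) eq) (sym (*-assoc x (x ^ leadingZeros p) _)))

-- The coefficient found after the leading zeros can only be 0 when the count has run off the end of
-- the list, that is, when all entries are 0.
leading≡0⇒eval≡0 : ∀ p → coeff p (leadingZeros p) ≡ 0ℤ → ∀ x → eval p x ≡ 0ℤ
leading≡0⇒eval≡0 []      _ x = refl
leading≡0⇒eval≡0 (b ∷ p) b≡0 x with b ℤₚ.≟ 0ℤ
... | no b≢0   = contradiction b≡0 b≢0
... | yes refl = trans (+-identityˡ _) (trans (cong (x *_) (leading≡0⇒eval≡0 p b≡0 x)) (*-zeroʳ x))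

-- Unit vectors and linear maps

-- `basis X` unfolds to the same expression, so facts about `unit` apply to it directly.
unit : Fin n → ℤⁿ n
unit j i = if does (j ≟ i) then 1ℤ else 0ℤ

unit-off : {i j : Fin n} → j ≢ i → unit j i ≡ 0ℤ
unit-off {i = i} {j} j≢i with j ≟ i
... | yes j≡i = contradiction j≡i j≢i
... | no _    = refl

unit-at : (i : Fin n) → unit i i ≡ 1ℤ
unit-at i with i ≟ i
... | yes _   = refl
... | no i≢i  = contradiction refl i≢i

detᶜ-unit : detᶜ (unit {n}) ≡ 1ℤ
detᶜ-unit {zero}  = refl
detᶜ-unit {suc n} = begin
  detᶜ (unit {suc n})
    ≡⟨ sum-δ {suc n} zero (λ j → sign j * (unit j zero * detᶜ (minor unit j))) (λ j j≢0 →
         trans (cong (λ x → sign j * (x * detᶜ (minor unit j))) (unit-off j≢0)) (*-zeroʳ (sign j))) ⟩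
  1ℤ * (1ℤ * detᶜ (unit {n}))   ≡⟨ cong (λ x → 1ℤ * (1ℤ * x)) (detᶜ-unit {n}) ⟩
  1ℤ                         ∎
  where open ≡-Reasoning

sum-unit : (y : ℤⁿ n) → ∀ i → sum (λ j → y j * unit j i) ≡ y i
sum-unit y i = begin
  sum (λ j → y j * unit j i)
    ≡⟨ sum-δ i (λ j → y j * unit j i) (λ j j≢i → trans (cong (y j *_) (unit-off j≢i)) (*-zeroʳ (y j))) ⟩
  y i * unit i i   ≡⟨ cong (y i *_) (unit-at i) ⟩
  y i * 1ℤ         ≡⟨ *-identityʳ (y i) ⟩
  y i              ∎
  where open ≡-Reasoning

module _ {f : ℤⁿ n → ℤⁿ k} (f-linear : Linear f) where

  open Linear f-linear

  linear-sum : (a : Vector ℤ m) (x : Vector (ℤⁿ n) m) →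
    f (λ i → sum (λ j → a j * x j i)) ≗ λ i → sum (λ j → a j * f (x j) i)
  linear-sum {zero}  a x i = ∙-null i
  linear-sum {suc m} a x i = begin
    f (λ i → a zero * x zero i + rest i) i          ≡⟨ ≗-cong (λ i → cong (_+_ (a zero * x zero i)) (sym (*-identityˡ (rest i)))) i ⟩
    f (λ i → a zero * x zero i + 1ℤ * rest i) i     ≡⟨ ∙-combine (a zero) 1ℤ (x zero) rest i ⟩
    a zero * f (x zero) i + 1ℤ * f rest i           ≡⟨ cong (_+_ (a zero * f (x zero) i)) (*-identityˡ (f rest i)) ⟩
    a zero * f (x zero) i + f rest i                ≡⟨ cong (_+_ (a zero * f (x zero) i)) (linear-sum (tail a) (tail x) i) ⟩
    sum (λ j → a j * f (x j) i)                     ∎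
    where
    open ≡-Reasoning
    rest = λ i → sum (λ j → a (suc j) * x (suc j) i)

  linear-expand : ∀ y → f y ≗ λ i → sum (λ j → y j * f (unit j) i)
  linear-expand y i = trans (≗-cong (λ l → sym (sum-unit y l)) i) (linear-sum y unit i)

  linear-scale : ∀ a x → f (λ i → a * x i) ≗ λ i → a * f x i
  linear-scale a x i = trans (≗-cong (λ l → sym (+-identityʳ (a * x l))) i)
    (trans (∙-combine a 0ℤ x x i) (+-identityʳ (a * f x i)))

  linear-difference : ∀ x y → f (λ i → x i - y i) ≗ λ i → f x i - f y i
  linear-difference x y i = trans (≗-cong (λ l → rearrange (x l) (y l)) i)
    (trans (∙-combine 1ℤ (- 1ℤ) x y i) (sym (rearrange (f x i) (f y i))))
    where
    rearrange : ∀ s t → s - t ≡ 1ℤ * s + (- 1ℤ) * t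
    rearrange = solve-∀

span-sum : {w : Vector (ℤⁿ n) m} (a : Vector ℤ k) {x : Vector (ℤⁿ n) k} → (∀ j → Span w (x j)) →
  Span w (λ i → sum (λ j → a j * x j i))
span-sum {k = zero}  a x∈ = null
span-sum {k = suc k} a {x} x∈ = respects
  (λ i → cong (_+_ (a zero * x zero i)) (*-identityˡ (sum λ j → a (suc j) * x (suc j) i)))
  (combine (a zero) 1ℤ (x∈ zero) (span-sum (tail a) (x∈ ∘ suc)))

i≢0∧i*j≡0⇒j≡0 : ∀ {a b} → a ≢ 0ℤ → a * b ≡ 0ℤ → b ≡ 0ℤ
i≢0∧i*j≡0⇒j≡0 {a} a≢0 ab≡0 with i*j≡0⇒i≡0∨j≡0 a ab≡0
... | inj₁ a≡0 = contradiction a≡0 a≢0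
... | inj₂ b≡0 = b≡0

-- A zero dᵢ is replaced by 1 in the torsion count, where only the residue 0
-- occurs at i, and by N in the determinant.
replace0 : ℕ → ℕ → ℕ
replace0 K zero    = K
replace0 K (suc d) = suc d

replace0-nonZero : ∀ K .{{_ : ℕ.NonZero K}} d → ℕ.NonZero (replace0 K d)
replace0-nonZero (suc _) zero    = _
replace0-nonZero (suc _) (suc d) = _

-- For K = N the second factor is the torsion order N itself, so the product of all coordinate
-- divisors is N^z · N.
product-replace0 : ∀ K (d : Vector ℕ n) →
  product (λ i → + replace0 K (d i)) ≡ (+ K) ^ zeros d * + ∏ (replace0 1 ∘ d)
product-replace0 {zero}  K d = refl
product-replace0 {suc n} K d with d zero
... | zero  = begin
  + K * product (λ i → + replace0 K (d (suc i)))   ≡⟨ cong (+ K *_) (product-replace0 K (tail d)) ⟩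
  + K * (P * + R)                                  ≡⟨ *-assoc (+ K) P (+ R) ⟨
  + K * P * + R                                    ≡⟨ cong (λ r → + K * P * + r) (ℕₚ.*-identityˡ R) ⟨
  + K * P * + (1 ℕ.* R)                            ∎
  where
  open ≡-Reasoning
  P = (+ K) ^ zeros (tail d)
  R = ∏ (replace0 1 ∘ tail d)
... | suc e = begin
  + suc e * product (λ i → + replace0 K (d (suc i)))   ≡⟨ cong (+ suc e *_) (product-replace0 K (tail d)) ⟩
  + suc e * (P * + R)                                  ≡⟨ swap (+ suc e) P (+ R) ⟩
  P * (+ suc e * + R)                                  ≡⟨ cong (P *_) (pos-* (suc e) R) ⟨
  P * + (suc e ℕ.* R)                                  ∎
  where
  open ≡-Reasoning
  P = (+ K) ^ zeros (tail d)
  R = ∏ (replace0 1 ∘ tail d)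
  swap : ∀ s p r → s * (p * r) ≡ p * (s * r)
  swap = solve-∀

^-monoʳ-∣ : ∀ a {k l} → k ℕ.≤ l → a ^ k ∣ a ^ l
^-monoʳ-∣ a {zero}  {l}     ℕ.z≤n     = divides (a ^ l) (sym (*-identityʳ (a ^ l)))
^-monoʳ-∣ a {suc k} {suc l} (ℕ.s≤s p) = *-monoʳ-∣ a (^-monoʳ-∣ a p)

-- The image of I - A and the values of g

module _ (X : FiniteDigraph) where

  open FiniteDigraph X
  open AbelianGroup (BF X) using (_≈_; rawMonoid)

  -- Equality of x and y in `BF X` unfolds to this predicate for x - y.
  Image : ℤⁿ ∣V∣ → Set
  Image x = ∃ λ z → x ≗ ℬℱ X z

  ℬℱ-linear : Linear (ℬℱ X)
  ℬℱ-linear = record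
    { ≗-cong = λ x≗y w → cong₂ _-_ (x≗y w) (sum-cong-≗ λ v → cong (_* targets X v w) (x≗y v))
    ; ∙-combine = λ a b x y w → begin
        a * x w + b * y w - 𝒜 X (λ v → a * x v + b * y v) w
          ≡⟨ cong (λ s → a * x w + b * y w - s) (trans
               (sum-cong-≗ λ v → distribute a b (x v) (y v) (targets X v w))
               (sum-linear a b (λ v → x v * targets X v w) (λ v → y v * targets X v w))) ⟩
        a * x w + b * y w - (a * 𝒜 X x w + b * 𝒜 X y w)
          ≡⟨ collect a b (x w) (y w) (𝒜 X x w) (𝒜 X y w) ⟩
        a * ℬℱ X x w + b * ℬℱ X y w ∎
    }
    where
    open ≡-Reasoning
    distribute : ∀ a b x y t → (a * x + b * y) * t ≡ a * (x * t) + b * (y * t)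
    distribute = solve-∀
    collect : ∀ a b x y s t → a * x + b * y - (a * s + b * t) ≡ a * (x - s) + b * (y - t)
    collect = solve-∀

  span⇒image : ∀ {x} → Span (λ j → ℬℱ X (basis X j)) x → Image x
  span⇒image (generator j) = basis X j , λ _ → refl
  span⇒image null = (λ _ → 0ℤ) , sym ∘ ∙-null
    where open Linear ℬℱ-linear
  span⇒image (combine a b x∈ y∈) with span⇒image x∈ | span⇒image y∈
  ... | z , x≗ | z′ , y≗ = (λ i → a * z i + b * z′ i) , λ i →
    trans (cong₂ (λ s t → a * s + b * t) (x≗ i) (y≗ i)) (sym (∙-combine a b z z′ i))
    where open Linear ℬℱ-linear
  span⇒image (respects x≗y x∈) with span⇒image x∈
  ... | z , x≗ = z , λ i → trans (sym (x≗y i)) (x≗ i)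

  image⇒span : ∀ {x} → Image x → Span (λ j → ℬℱ X (basis X j)) x
  image⇒span (z , x≗) = respects
    (λ i → sym (trans (x≗ i) (linear-expand ℬℱ-linear z i)))
    (span-sum z generator)

  adapted-image : Adapted Image
  adapted-image = adapted-⇔ span⇒image image⇒span (adapted-span _)

  image-resp : ∀ {x y} → x ≗ y → Image x → Image y
  image-resp x≗y (z , x≗) = z , λ i → trans (sym (x≗y i)) (x≗ i)

  -- The cokernel keeps the operations of ℤⁿ, so multiples agree on representatives and not merely
  -- up to the image.
  multiple-* : ∀ k x w → multiple rawMonoid k x w ≡ + k * x w
  multiple-* zero    x w = refl
  multiple-* (suc k) x w = trans (cong (_+_ (x w)) (multiple-* k x w)) (step (x w) (+ k))
    where
    step : ∀ y j → y + j * y ≡ (1ℤ + j) * y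
    step = solve-∀

  ·-* : ∀ a x w → _·_ (BF X) a x w ≡ a * x w
  ·-* (+ k)    x w = multiple-* k x w
  ·-* -[1+ k ] x w = trans (cong -_ (multiple-* (suc k) x w)) (neg-distribˡ-* (+ suc k) (x w))

  sumOf-· : (a : Vector ℤ k) (x : Vector (ℤⁿ ∣V∣) k) → ∀ w →
    sumOf rawMonoid (λ i → _·_ (BF X) (a i) (x i)) w ≡ sum (λ i → a i * x i w)
  sumOf-· {zero}  a x w = refl
  sumOf-· {suc k} a x w = cong₂ _+_ (·-* (a zero) (x zero) w) (sumOf-· (tail a) (tail x) w)

  column : ℤ → Fin ∣V∣ → ℤⁿ ∣V∣
  column x j i = matrix X id i j - matrix X (𝒜 X) i j * x

  eval-g : ∀ x → eval (g X) x ≡ detᶜ (column x)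
  eval-g x = trans
    (eval-det (λ i j → constant (matrix X id i j) +ₚ (-ₚ (constant (matrix X (𝒜 X) i j) *ₚ u))) x)
    (detᶜ-cong {c′ = column x} λ j i → entry (matrix X id i j) (matrix X (𝒜 X) i j))
    where
    open ≡-Reasoning
    entry : ∀ a b → eval (constant a +ₚ (-ₚ (constant b *ₚ u))) x ≡ a - b * x
    entry a b = begin
      eval (constant a +ₚ (-ₚ (constant b *ₚ u))) x
        ≡⟨ eval-+ (constant a) (-ₚ (constant b *ₚ u)) x ⟩
      eval (constant a) x + eval (-ₚ (constant b *ₚ u)) x
        ≡⟨ cong₂ _+_ (eval-constant a x) (trans (eval-neg (constant b *ₚ u) x) (cong -_
             (trans (eval-* (constant b) u x) (cong₂ _*_ (eval-constant b x) (eval-u x))))) ⟩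
      a - b * x ∎

  eval-g-0 : eval (g X) 0ℤ ≡ 1ℤ
  eval-g-0 = trans (eval-g 0ℤ) (trans
    (detᶜ-cong λ j i → trans (cong (λ y → basis X j i - y) (*-zeroʳ (𝒜 X (basis X j) i))) (+-identityʳ (basis X j i)))
    (detᶜ-unit {∣V∣}))

  -- Otherwise the Taylor list at 1 would be all zeros, yet its value at -1 is g(0) = 1.
  g*⟨1⟩≢0 : g*⟨1⟩ X ≢ 0ℤ
  g*⟨1⟩≢0 g*≡0 = contradiction
    (trans (sym eval-g-0) (trans (sym (eval-taylor 1ℤ (g X) (- 1ℤ)))
      (leading≡0⇒eval≡0 (taylor 1ℤ (g X)) g*≡0 (- 1ℤ))))
    λ ()

-- Torsion, rank and divisibility in adapted coordinates

module _ (X : FiniteDigraph) (adapted : Adapted (Image X)) where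

  open FiniteDigraph X
  open AbelianGroup (BF X) using (_≈_; rawMonoid)
  open Adapted adapted

  torsionOrder : ℕ
  torsionOrder = ∏ (replace0 1 ∘ d)

  private
    N = torsionOrder

  e-nonZero : ∀ i → ℕ.NonZero (replace0 1 (d i))
  e-nonZero i = replace0-nonZero 1 (d i)

  instance
    N-nonZero : ℕ.NonZero N
    N-nonZero = ∏-nonZero (replace0 1 ∘ d) e-nonZero

  N≢0 : + N ≢ 0ℤ
  N≢0 eq = ℕ.≢-nonZero⁻¹ N (+-injective eq)

  ≈⇒∣ : ∀ {x y} → x ≈ y → ∀ i → + d i ∣ to x i - to y i
  ≈⇒∣ {x} {y} x≈y i = subst (+ d i ∣_) (linear-difference to-linear x y i) (to-∣ x≈y i)

  ∣⇒≈ : ∀ {x y} → (∀ i → + d i ∣ to x i - to y i) → x ≈ y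
  ∣⇒≈ {x} {y} d∣ = ∣-to λ i → subst (+ d i ∣_) (sym (linear-difference to-linear x y i)) (d∣ i)

  -- At a free coordinate a multiple lying in the image must be 0, and ℤ has no zero divisors.
  torsion⇒to≡0 : ∀ {x} → IsTorsion (BF X) x → ∀ i → d i ≡ 0 → to x i ≡ 0ℤ
  torsion⇒to≡0 {x} (k , k≢0 , kx≈0) i di≡0 = i≢0∧i*j≡0⇒j≡0 {+ k} (k≢0 ∘ +-injective)
    (0∣⇒≡0 (subst₂ (λ c y → + c ∣ y) di≡0 (linear-scale to-linear (+ k) x i) (to-∣ kx∈ i)))
    where
    kx∈ : Image X (λ w → + k * x w)
    kx∈ = image-resp X (λ w → trans (+-identityʳ _) (multiple-* X k x w)) kx≈0

  -- N is an exponent that works for all such x at once, being a multiple of every nonzero d i.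
  to≡0⇒torsion : ∀ {x} → (∀ i → d i ≡ 0 → to x i ≡ 0ℤ) → IsTorsion (BF X) x
  to≡0⇒torsion {x} to≡0 = N , ℕ.≢-nonZero⁻¹ N ,
    image-resp X (λ w → sym (trans (+-identityʳ _) (multiple-* X N x w)))
      (∣-to λ i → subst (+ d i ∣_) (sym (linear-scale to-linear (+ N) x i)) (divisible i (d i) refl))
    where
    divisible : ∀ i k → d i ≡ k → + k ∣ + N * to x i
    divisible i zero    di≡k = divides 0ℤ (trans (cong (+ N *_) (to≡0 i di≡k)) (*-zeroʳ (+ N)))
    divisible i (suc k) di≡k = ∣m⇒∣m*n (to x i)
      (subst (λ c → + replace0 1 c ∣ + N) di≡k (∣∏ (replace0 1 ∘ d) i))

  residues : ℤⁿ ∣V∣ → ∀ i → Fin (replace0 1 (d i))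
  residues x i = residue (to x i) (replace0 1 (d i)) {{e-nonZero i}}

  representative : Fin N → ℤⁿ ∣V∣
  representative c = from λ i → + toℕ (decode (replace0 1 ∘ d) c i)

  to-representative : ∀ c i → to (representative c) i ≡ + toℕ (decode (replace0 1 ∘ d) c i)
  to-representative c = to∘from _

  representative-torsion : ∀ c → IsTorsion (BF X) (representative c)
  representative-torsion c = to≡0⇒torsion λ i di≡0 → trans (to-representative c i)
    (cong +_ (trivial (decode (replace0 1 ∘ d) c i) (cong (replace0 1) di≡0)))
    where
    trivial : ∀ {k} (c : Fin k) → k ≡ 1 → toℕ c ≡ 0
    trivial zero refl = refl

  -- The modulus 1 that stands in for 0 carries no information; vanishing of the free coordinates of
  -- torsion elements restores what is lost.
  e∣d : ∀ {y} k → (k ≡ 0 → y ≡ 0ℤ) → + replace0 1 k ∣ y → + k ∣ y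
  e∣d zero    y≡0 _  = divides 0ℤ (y≡0 refl)
  e∣d (suc k) y≡0 k∣ = k∣

  d∣e : ∀ {y} k → + k ∣ y → + replace0 1 k ∣ y
  d∣e zero    k∣ = subst (1ℤ ∣_) (sym (0∣⇒≡0 k∣)) (divides 0ℤ refl)
  d∣e (suc k) k∣ = k∣

  -- A torsion class is determined by its coordinates modulo the nonzero d i, and all residues
  -- occur.
  torsion-cardinality : HasCardinality (torsion (BF X)) N
  torsion-cardinality = record
    { to        = λ (x , _) → encode e (residues x)
    ; from      = λ c → representative c , representative-torsion c
    ; to-cong   = λ {x} {y} → residues-cong {x} {y}
    ; from-cong = λ { {c} refl → ∣⇒≈ {representative c} λ i → divides 0ℤ (+-inverseʳ (to (representative c) i)) }
    ; inverse   =
        (λ {c} {x} x≈c → trans (residues-cong {x} {representative c , representative-torsion c} x≈c) (trans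
          (encode-cong e λ i → trans
            (cong (λ y → residue y (e i) {{e-nonZero i}}) (to-representative c i))
            (residue-toℕ {{e-nonZero i}} (decode e c i)))
          (encode-decode e c)))
      , λ { {x , x-torsion} refl → ∣⇒≈ λ i → subst (λ y → + d i ∣ y - to x i)
          (sym (trans (to-representative (encode e (residues x)) i) (cong (+_ ∘ toℕ) (decode-encode e (residues x) i))))
          (e∣d (d i)
            (λ di≡0 → cong₂ _-_ (cong +_ (residue≡0 i di≡0 (residues x i))) (torsion⇒to≡0 x-torsion i di≡0))
            (residue-∣ (to x i) (e i) {{e-nonZero i}})) }
    }
    where
    e = replace0 1 ∘ d

    residues-cong : {x y : Σ (ℤⁿ ∣V∣) (IsTorsion (BF X))} → proj₁ x ≈ proj₁ y →
      encode e (residues (proj₁ x)) ≡ encode e (residues (proj₁ y))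
    residues-cong {x , _} {y , _} x≈y = encode-cong e λ i →
      residue-cong {to x i} {to y i} (e i) {{e-nonZero i}} (d∣e (d i) (≈⇒∣ {x} {y} x≈y i))

    residue≡0 : ∀ i → d i ≡ 0 → (r : Fin (e i)) → toℕ r ≡ 0
    residue≡0 i di≡0 r = ℕₚ.n<1⇒n≡0 (subst (toℕ r ℕ.<_) (cong (replace0 1) di≡0) (toℕ<n r))

  -- More elements than free coordinates satisfy a relation there. Multiplied by N it also holds
  -- modulo every nonzero d i, hence in the cokernel, and its coefficients do not all vanish.
  independent⇒≤zeros : (x : Vector (ℤⁿ ∣V∣) k) → LinearlyIndependent (BF X) x → k ℕ.≤ zeros d
  independent⇒≤zeros {k} x independent = ℕₚ.≮⇒≥ λ z<k →
    let a , (j , aj≢0) , a-relation = zeros<⇒relation d (to ∘ x) z<k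
        divisible : ∀ i c → d i ≡ c → + c ∣ + N * sum (λ j → a j * to (x j) i)
        divisible = λ
          { i zero    di≡c → divides 0ℤ (trans (cong (+ N *_) (a-relation i di≡c)) (*-zeroʳ (+ N)))
          ; i (suc c) di≡c → ∣m⇒∣m*n _ (subst (λ c → + replace0 1 c ∣ + N) di≡c (∣∏ (replace0 1 ∘ d) i)) }
        Na = λ j → + N * a j
        in-image : Image X (λ i → sum (λ j → Na j * x j i))
        in-image = ∣-to λ i → subst (+ d i ∣_)
          (sym (trans (linear-sum to-linear Na x i) (trans
            (sum-cong-≗ λ j → *-assoc (+ N) (a j) (to (x j) i))
            (sym (*-distribˡ-sum (+ N) λ j → a j * to (x j) i)))))
          (divisible i (d i) refl)
    in aj≢0 (i≢0∧i*j≡0⇒j≡0 N≢0 (independent Na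
         (image-resp X (λ w → sym (trans (+-identityʳ _) (sumOf-· X Na x w))) in-image) j))

  -- I − (1 + N) A = (1 + N) (I − A) − N I, and N kills the torsion of BF.
  column-∣ : ∀ j i → + replace0 N (d i) ∣ to (column X (1ℤ + + N) j) i
  column-∣ j i = subst (+ replace0 N (d i) ∣_) (sym to-column) (divisible (d i) refl)
    where
    b = basis X j

    rearrange : ∀ b a s → b - a * (1ℤ + s) ≡ (1ℤ + s) * (b - a) + (- s) * b
    rearrange = solve-∀

    to-column : to (column X (1ℤ + + N) j) i ≡ (1ℤ + + N) * to (ℬℱ X b) i + (- + N) * to b i
    to-column = trans (to-cong (λ l → rearrange (b l) (𝒜 X b l) (+ N)) i)
      (to-combine (1ℤ + + N) (- + N) (ℬℱ X b) b i)

    image-∣ : + d i ∣ to (ℬℱ X b) i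
    image-∣ = to-∣ (b , λ _ → refl) i

    divisible : ∀ k → d i ≡ k → + replace0 N k ∣ (1ℤ + + N) * to (ℬℱ X b) i + (- + N) * to b i
    divisible zero    di≡k = ∣m∣n⇒∣m+n
      (divides 0ℤ (trans
        (cong ((1ℤ + + N) *_) (0∣⇒≡0 (subst (λ k → + k ∣ to (ℬℱ X b) i) di≡k image-∣)))
        (*-zeroʳ (1ℤ + + N))))
      (∣m⇒∣m*n (to b i) (∣m⇒∣-m ∣-refl))
    divisible (suc k) di≡k = ∣m∣n⇒∣m+n
      (∣n⇒∣m*n (1ℤ + + N) (subst (λ k → + k ∣ to (ℬℱ X b) i) di≡k image-∣))
      (∣m⇒∣m*n (to b i) (∣m⇒∣-m (subst (λ k → + replace0 1 k ∣ + N) di≡k (∣∏ (replace0 1 ∘ d) i))))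

  -- The entries of `to c` are the coefficients of c in the basis `from (unit i)`; dividing them by
  -- their divisors moves those divisors onto the basis vectors.
  column-span : ∀ j → Span (λ i l → + replace0 N (d i) * from (unit i) l) (column X (1ℤ + + N) j)
  column-span j = respects expand (span-sum quotients generator)
    where
    open ≡-Reasoning
    c = column X (1ℤ + + N) j
    E = λ i → + replace0 N (d i)
    quotients = λ i → quotient (column-∣ j i)

    expand : (λ l → sum (λ i → quotients i * (E i * from (unit i) l))) ≗ c
    expand l = begin
      sum (λ i → quotients i * (E i * from (unit i) l))
        ≡⟨ sum-cong-≗ (λ i → trans (sym (*-assoc (quotients i) (E i) (from (unit i) l)))
             (cong (_* from (unit i) l) (sym (_∣_.equality (column-∣ j i))))) ⟩
      sum (λ i → to c i * from (unit i) l)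
        ≡⟨ linear-expand from-linear (to c) l ⟨
      from (to c) l
        ≡⟨ from∘to c l ⟩
      c l ∎

  power-∣-g : (+ N) ^ zeros d * + N ∣ eval (g X) (1ℤ + + N)
  power-∣-g = subst₂ _∣_ (product-replace0 N d) (sym (eval-g X (1ℤ + + N)))
    (product∣detᶜ (λ i → + replace0 N (d i)) (λ i → from (unit i)) (column X (1ℤ + + N)) column-span)

  -- By r ≤ z, N^r · N divides N^z · N and therefore g(1 + N). Cancelling the nonzero N^r leaves N
  -- dividing g*(1) + N t.
  torsionOrder∣g*⟨1⟩ : r X ℕ.≤ zeros d → + N ∣ g*⟨1⟩ X
  torsionOrder∣g*⟨1⟩ r≤z with eval-leading (taylor 1ℤ (g X)) (+ N)
  ... | t , leading = ∣m+n∣n⇒∣m {m = g*⟨1⟩ X} {n = + N * t}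
    (*-cancelˡ-∣ ((+ N) ^ r X) {{≢-nonZero λ eq → N≢0 (i^n≡0⇒i≡0 (+ N) (r X) eq)}}
      (∣-trans (*-monoˡ-∣ (+ N) (^-monoʳ-∣ (+ N) r≤z))
        (subst ((+ N) ^ zeros d * + N ∣_) (trans (sym (eval-taylor 1ℤ (g X) (+ N))) leading) power-∣-g)))
    (∣m⇒∣m*n t ∣-refl)

theorem2p6 : (X : FiniteDigraph) →
    StronglyConnected X →
    (ρ : ℕ) → HasRank (BF X) ρ →
    δ X ρ ≡ 0ℤ →
    ∃[ N ] (HasCardinality (torsion (BF X)) N ×
    (∃[ m ] (m ≢ 0ℤ × g*⟨1⟩ X ≡ m * (+ N))))
theorem2p6 X _ ρ ((x , independent) , _) δ≡0 =
  let A = adapted-image X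
      r≡ρ = +-injective (i-j≡0⇒i≡j (+ r X) (+ ρ) δ≡0)
      -- The family of ρ = r independent elements of BF(X) bounds r by the number of free
      -- coordinates.
      divides m g*≡mN = torsionOrder∣g*⟨1⟩ X A (subst (ℕ._≤ _) (sym r≡ρ) (independent⇒≤zeros X A x independent))
  in torsionOrder X A , torsion-cardinality X A , m ,
     (λ m≡0 → g*⟨1⟩≢0 X (trans g*≡mN (cong (_* + torsionOrder X A) m≡0))) , g*≡mN
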